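{- Let $P$ be a finite interval order. A cycle inequality of the key graph $G_P$ is redundant if and only if it is a non-negative integral linear combination of cycle inequalities that are smaller than it in the weak order.
   Context: A finite partial order $P=([n],\prec)$ is an interval order if there are compact real intervals $I_x=[\ell_x,r_x]$ with $x\prec y$ iff $r_x<\ell_y$; write $x\parallel y$ if $x\ne y$ are incomparable. The canonical representation $[\ell_x,r_x]_{x\in[n]}$ of $P$ is the (unique) representation using the minimum number $m$ of distinct endpoints, placed at $0,\dots,m-1$. For $y\not\prec x$, the slack of $(x,y)$ there is $\ell_y-r_x-1$ if $x\prec y$, $r_y-\ell_x$ if $x\parallel y$, $r_x-\ell_x$ if $x=y$; slack-$0$ pairs are slack zero pairs, called cover pairs if $x\prec y$ and sharp pairs if $x\parallel y$. The key graph $G_P$ has vertex set $\{\rho_1,\dots,\rho_n\}$ and colored, weighted arcs (weights being linear inequalities in $\ell_1,\dots,\ell_n,\rho_1,\dots,\rho_n$): a blue arc $\rho_x\to\rho_y$ of weight $\langle\ell_x+\rho_x+1\le\ell_y\rangle$ for each slack zero cover pair; a red arc $\rho_x\to\rho_y$ of weight $\langle\ell_x\le\ell_y+\rho_y\rangle$ for each slack zero sharp pair; a red loop at $\rho_x$ of weight $\langle-\rho_x\le0\rangle$ for each slack zero pair $(x,x)$. For a directed cycle $C$ (loops included), the termwise sum of its arc weights (with cancellation) is its cycle inequality $\langle\gamma+\sum_{i\in A}\rho_i\le\sum_{j\in B}\rho_j\rangle$, where $\gamma$ is the number of blue arcs of $C$ and, for consecutive arcs $\rho_x\to\rho_y\to\rho_z$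 of $C$, $y\in A$ if both are blue and $y\in B$ if both are red ($A\cap B=\emptyset$). Inequalities are equivalent if they coincide after simplification. A cycle inequality $W$ is redundant if $W=\sum_i\alpha_iW_i$ for finitely many cycle inequalities $W_i$ not equivalent to $W$ and rational $\alpha_i\ge0$. The weak order on cycle inequalities: $\langle\gamma_1+\sum_{A_1}\rho_i\le\sum_{B_1}\rho_j\rangle$ is smaller than $\langle\gamma_2+\sum_{A_2}\rho_i\le\sum_{B_2}\rho_j\rangle$ iff $\gamma_1<\gamma_2$, or ($\gamma_1=\gamma_2$ and $|A_2|<|A_1|$), or ($\gamma_1=\gamma_2$, $|A_1|=|A_2|$ and $|B_1|<|B_2|$). -}

module Defs where

open import Data.Nat as ℕ using (ℕ; zero; suc; _<_; _≤_; _+_)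
open import Data.Nat.Properties using (_≟_)
open import Data.Integer as ℤ using (ℤ; +_; -_; 0ℤ; 1ℤ)
open import Data.Rational as ℚ using (ℚ; 0ℚ)
open import Data.Fin using (Fin; zero; suc)
open import Data.List using (List; []; _∷_; map; _++_; length; deduplicate; allFin)
open import Data.List.Membership.Propositional using (_∈_)
open import Data.List.Relation.Unary.All using (All)
open import Data.Bool using (Bool; true; false; _∧_; if_then_else_)
open import Data.Product using (Σ; _×_; _,_; proj₁; proj₂; ∃)
open import Relation.Binary.PropositionalEquality using (_≡_; _≢_)
open import Relation.Nullary using (¬_)
open import Function.Bundles using (_⇔_)
import Data.Sum
import Relation.Nullary
import Data.Fin

-- Interval representations on [n] = Fin n with natural-number endpoints.
-- An element x is the interval [ℓ x , r x].

module _ {n : ℕ} (ℓ r : Fin n → ℕ) where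

  _≺_ : Fin n → Fin n → Set
  x ≺ y = r x < ℓ y

  _∥_ : Fin n → Fin n → Set
  x ∥ y = (x ≢ y) × ¬ (x ≺ y) × ¬ (y ≺ x)

  endpoints : List ℕ
  endpoints = map ℓ (allFin n) ++ map r (allFin n)

  numEndpoints : ℕ
  numEndpoints = length (deduplicate _≟_ endpoints)

  IsRepr : Set
  IsRepr = ∀ x → ℓ x ≤ r x

  IsCanonical : Set
  IsCanonical =
    IsRepr
    × (∀ (ℓ' r' : Fin n → ℕ) → (∀ x → ℓ' x ≤ r' x)
         → (∀ x y → (r x < ℓ y) ⇔ (r' x < ℓ' y))
         → numEndpoints ≤ numEndpoints' ℓ' r')
    × (∀ x → ℓ x < numEndpoints × r x < numEndpoints)
    × (∀ k → k < numEndpoints → k ∈ endpoints)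
    where
      numEndpoints' : (Fin n → ℕ) → (Fin n → ℕ) → ℕ
      numEndpoints' ℓ' r' =
        length (deduplicate _≟_ (map ℓ' (allFin n) ++ map r' (allFin n)))

  -- cover pair x ≺ y of slack ℓ_y - r_x - 1 = 0
  CoverZero : Fin n → Fin n → Set
  CoverZero x y = (x ≺ y) × (ℓ y ≡ r x + 1)

  -- sharp pair x ∥ y of slack r_y - ℓ_x = 0
  SharpZero : Fin n → Fin n → Set
  SharpZero x y = (x ∥ y) × (r y ≡ ℓ x)

  -- pair (x , x) of slack r_x - ℓ_x = 0
  SelfZero : Fin n → Set
  SelfZero x = r x ≡ ℓ x

  -- The key graph G_P: vertices ρ_1..ρ_n (indexed by Fin n), arcs:

  data Arc : Fin n → Fin n → Set where
    blue : ∀ {x y} → CoverZero x y → Arc x y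
    red  : ∀ {x y} → SharpZero x y → Arc x y
    loop : ∀ {x} → SelfZero x → Arc x x

  -- a linear inequality  Σ_v c_v · v ≤ 0  in the variables
  -- ℓ_1..ℓ_n, ρ_1..ρ_n and a constant term, stored by its coefficients
  -- (inequality  L ≤ R  is stored as  L - R ≤ 0)
  data Var : Set where
    ℓv   : Fin n → Var
    ρv   : Fin n → Var
    cst  : Var

  LinIneq : Set
  LinIneq = Var → ℤ

  δ : Fin n → Fin n → ℤ
  δ i j with Data.Fin._≟_ i j
  ... | Relation.Nullary.yes _ = 1ℤ
  ... | Relation.Nullary.no  _ = 0ℤ

  -- weights of arcs
  --   blue ρx→ρy : ⟨ ℓx + ρx + 1 ≤ ℓy ⟩
  --   red  ρx→ρy : ⟨ ℓx ≤ ℓy + ρy ⟩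
  --   loop ρx    : ⟨ -ρx ≤ 0 ⟩
  weight : ∀ {x y} → Arc x y → LinIneq
  weight {x} {y} (blue _) (ℓv i) = δ x i ℤ.- δ y i
  weight {x} {y} (blue _) (ρv i) = δ x i
  weight {x} {y} (blue _) cst    = 1ℤ
  weight {x} {y} (red _)  (ℓv i) = δ x i ℤ.- δ y i
  weight {x} {y} (red _)  (ρv i) = ℤ.- δ y i
  weight {x} {y} (red _)  cst    = 0ℤ
  weight {x} {y} (loop _) (ℓv i) = 0ℤ
  weight {x} {y} (loop _) (ρv i) = ℤ.- δ x i
  weight {x} {y} (loop _) cst    = 0ℤ

  isBlue : ∀ {x y} → Arc x y → Bool
  isBlue (blue _) = true
  isBlue (red _)  = false
  isBlue (loop _) = false

  isRed : ∀ {x y} → Arc x y → Bool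
  isRed (blue _) = false
  isRed (red _)  = true
  isRed (loop _) = true

next : ∀ {k} → Fin (suc k) → Fin (suc k)
next {zero} zero = zero
next {suc k} zero = suc zero
next {suc k} (suc i) with next {k} i
... | zero = zero
... | suc j = suc (suc j)

sumFin : ∀ {k} → (Fin k → ℤ) → ℤ
sumFin {zero} f = 0ℤ
sumFin {suc k} f = f zero ℤ.+ sumFin (λ i → f (suc i))

countFin : ∀ {k} → (Fin k → Bool) → ℕ
countFin {zero} f = 0
countFin {suc k} f = (if f zero then 1 else 0) + countFin (λ i → f (suc i))

module _ {n : ℕ} (ℓ r : Fin n → ℕ) where

  record Cycle : Set where
    field
      len    : ℕ                       -- number of vertices minus one
      vert   : Fin (suc len) → Fin n
      inj    : ∀ i j → vert i ≡ vert j → i ≡ j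
      arc    : ∀ i → Arc ℓ r (vert i) (vert (next i))
  open Cycle public

  cycleIneq : Cycle → LinIneq ℓ r
  cycleIneq C v = sumFin (λ i → weight ℓ r (arc C i) v)

  γ : Cycle → ℕ
  γ C = countFin (λ i → isBlue ℓ r (arc C i))

  sizeA : Cycle → ℕ
  sizeA C = countFin (λ i → isBlue ℓ r (arc C i) ∧ isBlue ℓ r (arc C (next i)))

  sizeB : Cycle → ℕ
  sizeB C = countFin (λ i → isRed ℓ r (arc C i) ∧ isRed ℓ r (arc C (next i)))

  WeakSmaller : Cycle → Cycle → Set
  WeakSmaller C₁ C₂ =
    (γ C₁ < γ C₂)
    Data.Sum.⊎ ((γ C₁ ≡ γ C₂) × (sizeA C₂ < sizeA C₁))
    Data.Sum.⊎ ((γ C₁ ≡ γ C₂) × (sizeA C₁ ≡ sizeA C₂) × (sizeB C₁ < sizeB C₂))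

  Equiv : LinIneq ℓ r → LinIneq ℓ r → Set
  Equiv W W' = ∀ v → W v ≡ W' v

  toℚ : ℤ → ℚ
  toℚ z = z ℚ./ 1

  sumℚ : List (ℚ × Cycle) → Var ℓ r → ℚ
  sumℚ [] v = 0ℚ
  sumℚ ((α , C) ∷ L) v = α ℚ.* toℚ (cycleIneq C v) ℚ.+ sumℚ L v

  sumℕ : List (ℕ × Cycle) → Var ℓ r → ℤ
  sumℕ [] v = 0ℤ
  sumℕ ((k , C) ∷ L) v = (+ k) ℤ.* cycleIneq C v ℤ.+ sumℕ L v

  Redundant : Cycle → Set
  Redundant C = Σ (List (ℚ × Cycle)) λ L →
    All (λ p → (0ℚ ℚ.≤ proj₁ p) × ¬ Equiv (cycleIneq (proj₂ p)) (cycleIneq C)) L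
    × (∀ v → toℚ (cycleIneq C v) ≡ sumℚ L v)

  IntCombSmaller : Cycle → Set
  IntCombSmaller C = Σ (List (ℕ × Cycle)) λ L →
    All (λ p → WeakSmaller (proj₂ p) C) L
    × (∀ v → cycleIneq C v ≡ sumℕ L v)

{-# OPTIONS --safe #-}

-- Colour the arcs blue and red; an arc leaves its source at an endpoint and reaches its target at
-- an endpoint, and it exists as soon as these match, so arcs of equal colour and level can exchange
-- their targets. If a cycle has two such arcs, or turns at two vertices which a single vertex x can
-- replace, it splits into two closed paths with the same total inequality, hence into at least two
-- cycles; each summand is smaller in the weak order, because what is left over has either a blue
-- arc or only nonpositive coefficients. Otherwise the cycle C is rigid. Several linear functionals
-- of the coefficients are nonnegative on cycles and vanish on C, so they vanish on every cycle D
-- with a positive weight in a combination equal to C. This forces D to follow C arc by arc, so D is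
-- equivalent to C and C is not redundant.

module Submission where

open import Defs
open import Algebra.Bundles using (CommutativeMonoid)
import Algebra.Properties.CommutativeSemigroup as CommutativeSemigroup
open import Data.Bool using (Bool; true; false; _∧_; not; if_then_else_)
import Data.Bool.Properties as Bool
open import Data.Fin using (Fin; zero; suc; toℕ)
open import Data.Fin.Properties using (_≟_; any?; suc-injective; toℕ<n; toℕ-injective)
open import Data.Integer as ℤ using (ℤ; -_; _+_; _-_; _*_; _≤_; 0ℤ; 1ℤ; _⊔_) renaming (+_ to pos)
import Data.Integer.Properties as ℤ
open import Data.Integer.Tactic.RingSolver using (solve-∀)
open import Data.List using (List; []; _∷_; _++_; length; map)
open import Data.List.Membership.Propositional using (_∈_)
open import Data.List.Properties using (length-++)
open import Data.List.Relation.Unary.All as All using (All; []; _∷_)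
import Data.List.Relation.Unary.All.Properties as All
open import Data.List.Relation.Unary.Any using (here; there)
open import Data.Nat as ℕ using (ℕ; zero; suc; _<ᵇ_; _≤′_; ≤′-reflexive; ≤′-step)
import Data.Nat.Properties as ℕ
open import Data.Product using (Σ; ∃; _×_; _,_; proj₁; proj₂)
open import Data.Rational as ℚ using (ℚ; 0ℚ)
import Data.Rational.Properties as ℚ
open import Data.Rational.Unnormalised as ℚᵘ using (mkℚᵘ; *≡*; *≤*)
import Data.Rational.Unnormalised.Properties as ℚᵘ
open import Data.Sum using (_⊎_; inj₁; inj₂)
open import Data.Unit using (⊤; tt)
open import Function using (_∘_)
open import Function.Bundles using (_⇔_; mk⇔)
open import Relation.Binary.Definitions using (tri<; tri≈; tri>)
open import Relation.Binary.PropositionalEquality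
open import Relation.Nullary using (¬_; Dec; yes; no; contradiction; does)
open import Relation.Nullary.Decidable using (_×-dec_; ¬?; decidable-stable)

-- Finite sums and the cyclic successor

-- A vertex where the colour changes leaves no trace in the inequality: its ρ terms are absent or
-- cancel, and its ℓ terms telescope. No functional of the coefficients can identify it, so a
-- summand `D` may differ from `C` there. The comparison therefore follows colours and levels, and
-- fixes a vertex only where `C` keeps its colour. The same invisibility allows a turning vertex to
-- be replaced before a split. Splitting at two opposite turns answers an obstacle in the
-- comparison: `D` might run straight through a vertex that fits both turns of `C`. The functionals
-- exist because the number of arcs of a given colour and level is itself linear in the ρ
-- coefficients: it is minus the sum of the coefficients of the intervals meeting a given point or
-- gap. One split already yields smaller cycles, each listed with weight 1, so integrality needs no
-- induction on the weak order.

sumFin-cong : ∀ {k} {f g : Fin k → ℤ} → (∀ i → f i ≡ g i) → sumFin f ≡ sumFin g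
sumFin-cong {zero}  f≗g = refl
sumFin-cong {suc k} f≗g = cong₂ _+_ (f≗g zero) (sumFin-cong (f≗g ∘ suc))

sumFin-0 : ∀ {k} {f : Fin k → ℤ} → (∀ i → f i ≡ 0ℤ) → sumFin f ≡ 0ℤ
sumFin-0 {zero}  f≗0 = refl
sumFin-0 {suc k} f≗0 = cong₂ _+_ (f≗0 zero) (sumFin-0 (f≗0 ∘ suc))

+-interchange : ∀ a b c d → (a + b) + (c + d) ≡ (a + c) + (b + d)
+-interchange = solve-∀

sumFin-+ : ∀ {k} (f g : Fin k → ℤ) → sumFin (λ i → f i + g i) ≡ sumFin f + sumFin g
sumFin-+ {zero}  f g = refl
sumFin-+ {suc k} f g = trans (cong ((f zero + g zero) +_) (sumFin-+ (f ∘ suc) (g ∘ suc)))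
  (+-interchange (f zero) (g zero) (sumFin (f ∘ suc)) (sumFin (g ∘ suc)))

sumFin-neg : ∀ {k} (f : Fin k → ℤ) → sumFin (λ i → - f i) ≡ - sumFin f
sumFin-neg {zero}  f = refl
sumFin-neg {suc k} f = trans (cong ((- f zero) +_) (sumFin-neg (f ∘ suc)))
  (sym (ℤ.neg-distrib-+ (f zero) (sumFin (f ∘ suc))))

sumFin-- : ∀ {k} (f g : Fin k → ℤ) → sumFin (λ i → f i - g i) ≡ sumFin f - sumFin g
sumFin-- f g = trans (sumFin-+ f (-_ ∘ g)) (cong (sumFin f +_) (sumFin-neg g))

sumFin-*ˡ : ∀ {k} (a : ℤ) (f : Fin k → ℤ) → sumFin (λ i → a * f i) ≡ a * sumFin f
sumFin-*ˡ {zero}  a f = sym (ℤ.*-zeroʳ a)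
sumFin-*ˡ {suc k} a f = trans (cong ((a * f zero) +_) (sumFin-*ˡ a (f ∘ suc)))
  (sym (ℤ.*-distribˡ-+ a (f zero) (sumFin (f ∘ suc))))

sumFin-swap : ∀ {k m} (f : Fin k → Fin m → ℤ) →
  sumFin (λ i → sumFin (f i)) ≡ sumFin (λ j → sumFin (λ i → f i j))
sumFin-swap {zero}  f = sym (sumFin-0 {f = λ j → sumFin {zero} (λ i → f i j)} λ _ → refl)
sumFin-swap {suc k} f = trans (cong (sumFin (f zero) +_) (sumFin-swap (f ∘ suc)))
  (sym (sumFin-+ (f zero) (λ j → sumFin (λ i → f (suc i) j))))

sumFin-nonNeg : ∀ {k} {f : Fin k → ℤ} → (∀ i → 0ℤ ≤ f i) → 0ℤ ≤ sumFin f
sumFin-nonNeg {zero}  0≤f = ℤ.≤-refl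
sumFin-nonNeg {suc k} 0≤f = ℤ.+-mono-≤ (0≤f zero) (sumFin-nonNeg (0≤f ∘ suc))

sumFin-mono : ∀ {k} {f g : Fin k → ℤ} → (∀ i → f i ≤ g i) → sumFin f ≤ sumFin g
sumFin-mono {zero}  f≤g = ℤ.≤-refl
sumFin-mono {suc k} f≤g = ℤ.+-mono-≤ (f≤g zero) (sumFin-mono (f≤g ∘ suc))

a+b≡0⇒a≡0 : ∀ {a b} → 0ℤ ≤ a → 0ℤ ≤ b → a + b ≡ 0ℤ → a ≡ 0ℤ
a+b≡0⇒a≡0 {a} {b} 0≤a 0≤b a+b≡0 = ℤ.≤-antisym
  (subst (a ≤_) a+b≡0 (subst (_≤ a + b) (ℤ.+-identityʳ a) (ℤ.+-monoʳ-≤ a 0≤b))) 0≤a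

sumFin≡0 : ∀ {k} {f : Fin k → ℤ} → (∀ i → 0ℤ ≤ f i) → sumFin f ≡ 0ℤ → ∀ i → f i ≡ 0ℤ
sumFin≡0 {f = f} 0≤f Σ≡0 zero    = a+b≡0⇒a≡0 (0≤f zero) (sumFin-nonNeg (0≤f ∘ suc)) Σ≡0
sumFin≡0 {f = f} 0≤f Σ≡0 (suc i) = sumFin≡0 (0≤f ∘ suc)
  (a+b≡0⇒a≡0 (sumFin-nonNeg (0≤f ∘ suc)) (0≤f zero)
    (trans (ℤ.+-comm (sumFin (f ∘ suc)) (f zero)) Σ≡0)) i

𝟙 : Bool → ℤ
𝟙 b = if b then 1ℤ else 0ℤ

countFin-sum : ∀ {k} (f : Fin k → Bool) → pos (countFin f) ≡ sumFin (𝟙 ∘ f)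
countFin-sum {zero}  f = refl
countFin-sum {suc k} f with f zero
... | true  = cong (1ℤ +_) (countFin-sum (f ∘ suc))
... | false = trans (countFin-sum (f ∘ suc)) (sym (ℤ.+-identityˡ _))

sumFin-pick : ∀ {k} (f : Fin k → ℤ) i → (∀ j → j ≢ i → f j ≡ 0ℤ) → sumFin f ≡ f i
sumFin-pick f zero    f≗0 = trans (cong (f zero +_) (sumFin-0 λ j → f≗0 (suc j) λ ())) (ℤ.+-identityʳ _)
sumFin-pick f (suc i) f≗0 = trans (cong₂ _+_ (f≗0 zero λ ()) (sumFin-pick (f ∘ suc) i λ j j≢i → f≗0 (suc j) (j≢i ∘ suc-injective)))
  (ℤ.+-identityˡ _)

-- A map on Fin (suc k) with its value at zero replaced by w; composed with next, it describes
-- the successors along a path whose last arc is redirected to w.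
redirect : ∀ {A : Set} {k} → A → (Fin k → A) → Fin (suc k) → A
redirect w f zero    = w
redirect w f (suc j) = f j

redirect-eta : ∀ {A : Set} {k} (f : Fin (suc k) → A) j → redirect (f zero) (f ∘ suc) j ≡ f j
redirect-eta f zero    = refl
redirect-eta f (suc j) = refl

redirect-next : ∀ {A : Set} {k} (w : A) (f : Fin (suc k) → A) i →
  redirect w f (next (suc i)) ≡ redirect w (f ∘ suc) (next i)
redirect-next w f i with next i
... | zero  = refl
... | suc j = refl

-- Deleting the first index changes where the last one wraps, so invariance under the cyclic shift
-- is not inductive as it stands. Leaving the wrapped value `w` free makes the induction work.
sumFin-redirect : ∀ {k} w (f : Fin k → ℤ) → sumFin (redirect w f ∘ next) ≡ w + sumFin f
sumFin-redirect {zero}  w f = refl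
sumFin-redirect {suc k} w f = trans
  (cong (f zero +_) (trans (sumFin-cong (redirect-next w f)) (sumFin-redirect w (f ∘ suc))))
  (swap (f zero) w (sumFin (f ∘ suc)))
  where
  swap : ∀ a b c → a + (b + c) ≡ b + (a + c)
  swap = solve-∀

sumFin-next : ∀ {k} (f : Fin (suc k) → ℤ) → sumFin (f ∘ next) ≡ sumFin f
sumFin-next f = trans (sumFin-cong (sym ∘ redirect-eta f ∘ next)) (sumFin-redirect (f zero) (f ∘ suc))

next-injective : ∀ {k} {i j : Fin (suc k)} → next i ≡ next j → i ≡ j
next-injective {zero}  {zero}  {zero}  eq = refl
next-injective {suc k} {zero}  {zero}  eq = refl
next-injective {suc k} {zero}  {suc j} eq with next j
next-injective {suc k} {zero}  {suc j} () | zero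
next-injective {suc k} {zero}  {suc j} () | suc _
next-injective {suc k} {suc i} {zero}  eq with next i
next-injective {suc k} {suc i} {zero}  () | zero
next-injective {suc k} {suc i} {zero}  () | suc _
next-injective {suc k} {suc i} {suc j} eq = cong suc (next-injective (lemma eq))
  where
  lemma : next (suc i) ≡ next (suc j) → next i ≡ next j
  lemma eq with next i | next j
  lemma eq   | zero  | zero  = refl
  lemma refl | suc a | suc _ = refl

next-toℕ : ∀ {k} (i : Fin (suc k)) → toℕ i ℕ.< k → toℕ (next i) ≡ suc (toℕ i)
next-toℕ {suc k} zero    i<k = refl
next-toℕ {suc k} (suc i) (ℕ.s≤s i<k) with next i | next-toℕ i i<k
... | suc j | eq = cong suc eq

next-last : ∀ {k} (i : Fin (suc k)) → toℕ i ≡ k → next i ≡ zero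
next-last {zero}  zero    eq = refl
next-last {suc k} (suc i) eq with next i | next-last i (ℕ.suc-injective eq)
... | zero | refl = refl

orbit : ∀ {k} → ℕ → Fin (suc k)
orbit zero    = zero
orbit (suc t) = next (orbit t)

toℕ-orbit : ∀ {k} t → t ℕ.≤ k → toℕ (orbit {k} t) ≡ t
toℕ-orbit zero    t≤k = refl
toℕ-orbit (suc t) t<k = trans
  (next-toℕ (orbit t) (subst (ℕ._< _) (sym (toℕ-orbit t (ℕ.<⇒≤ t<k))) t<k))
  (cong suc (toℕ-orbit t (ℕ.<⇒≤ t<k)))

orbit-toℕ : ∀ {k} (i : Fin (suc k)) → orbit (toℕ i) ≡ i
orbit-toℕ i = toℕ-injective (toℕ-orbit (toℕ i) (ℕ.s≤s⁻¹ (toℕ<n i)))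

orbit-period : ∀ {k} → orbit {k} (suc k) ≡ zero
orbit-period {k} = next-last (orbit k) (toℕ-orbit k ℕ.≤-refl)

-- Induction on a cycle from an arbitrary base point: `suc k ∸ toℕ i` steps lead from `i` past the
-- last index to zero, and from zero every index is reached.
next-induction : ∀ {k} (P : Fin (suc k) → Set) → (∀ {i} → P i → P (next i)) →
  ∀ {i} → P i → ∀ j → P j
next-induction {k} P step {i} Pi j = subst P (orbit-toℕ j) (from-zero (toℕ j))
  where
  ascend : ∀ s {t} → P (orbit t) → P (orbit (s ℕ.+ t))
  ascend zero    p = p
  ascend (suc s) p = step (ascend s p)

  from-zero : ∀ t → P (orbit t)
  from-zero zero    = subst P
    (trans (cong orbit (ℕ.m∸n+n≡m (ℕ.<⇒≤ (toℕ<n i)))) orbit-period)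
    (ascend (suc k ℕ.∸ toℕ i) (subst P (sym (orbit-toℕ i)) Pi))
  from-zero (suc t) = step (from-zero t)

next-surjective : ∀ {k} (j : Fin (suc k)) → ∃ λ i → next i ≡ j
next-surjective {k} = next-induction (λ j → ∃ λ i → next i ≡ j) (λ {i} _ → i , refl) {next zero} (zero , refl)

-- The last term is split off, to match walk segments indexed by `≤′`, which grow by their last arc.
sumℕ< : ℕ → (ℕ → ℤ) → ℤ
sumℕ< zero    f = 0ℤ
sumℕ< (suc t) f = sumℕ< t f + f t

sumℕ<-suc : ∀ t f → sumℕ< (suc t) f ≡ f 0 + sumℕ< t (f ∘ suc)
sumℕ<-suc zero    f = ℤ.+-comm 0ℤ (f 0)
sumℕ<-suc (suc t) f = trans (cong (_+ f (suc t)) (sumℕ<-suc t f)) (ℤ.+-assoc (f 0) _ _)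

sumFin-toℕ : ∀ {k} (f : ℕ → ℤ) → sumFin {k} (f ∘ toℕ) ≡ sumℕ< k f
sumFin-toℕ {zero}  f = refl
sumFin-toℕ {suc k} f = trans (cong (f 0 +_) (sumFin-toℕ {k} (f ∘ suc))) (sym (sumℕ<-suc k f))

sumFin-orbit : ∀ {k} (f : Fin (suc k) → ℤ) → sumFin f ≡ sumℕ< (suc k) (f ∘ orbit)
sumFin-orbit {k} f = trans (sumFin-cong (sym ∘ cong f ∘ orbit-toℕ)) (sumFin-toℕ {suc k} (f ∘ orbit))

sumFin-nonPos : ∀ {k} {f : Fin k → ℤ} → (∀ i → f i ≤ 0ℤ) → sumFin f ≤ 0ℤ
sumFin-nonPos {zero}  f≤0 = ℤ.≤-refl
sumFin-nonPos {suc k} f≤0 = ℤ.+-mono-≤ (f≤0 zero) (sumFin-nonPos (f≤0 ∘ suc))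

-- Integers as rationals

ι : ℤ → ℚ
ι z = z ℚ./ 1

ι-toℚᵘ : ∀ z → ℚ.toℚᵘ (ι z) ℚᵘ.≃ mkℚᵘ z 0
ι-toℚᵘ z = ℚ.toℚᵘ-fromℚᵘ (mkℚᵘ z 0)

ι-+ : ∀ a b → ι (a + b) ≡ ι a ℚ.+ ι b
ι-+ a b = ℚ.toℚᵘ-injective (begin
    ℚ.toℚᵘ (ι (a + b))                  ≈⟨ ι-toℚᵘ (a + b) ⟩
    mkℚᵘ (a + b) 0                      ≈⟨ *≡* (scale a b) ⟩
    mkℚᵘ a 0 ℚᵘ.+ mkℚᵘ b 0              ≈⟨ ℚᵘ.+-cong (ι-toℚᵘ a) (ι-toℚᵘ b) ⟨
    ℚ.toℚᵘ (ι a) ℚᵘ.+ ℚ.toℚᵘ (ι b)      ≈⟨ ℚ.toℚᵘ-homo-+ (ι a) (ι b) ⟨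
    ℚ.toℚᵘ (ι a ℚ.+ ι b)                ∎)
  where
  open import Relation.Binary.Reasoning.Setoid ℚᵘ.≃-setoid
  scale : ∀ a b → (a + b) * 1ℤ ≡ (a * 1ℤ + b * 1ℤ) * 1ℤ
  scale = solve-∀

ι-* : ∀ a b → ι (a * b) ≡ ι a ℚ.* ι b
ι-* a b = ℚ.toℚᵘ-injective (begin
    ℚ.toℚᵘ (ι (a * b))                  ≈⟨ ι-toℚᵘ (a * b) ⟩
    mkℚᵘ a 0 ℚᵘ.* mkℚᵘ b 0              ≈⟨ ℚᵘ.*-cong (ι-toℚᵘ a) (ι-toℚᵘ b) ⟨
    ℚ.toℚᵘ (ι a) ℚᵘ.* ℚ.toℚᵘ (ι b)      ≈⟨ ℚ.toℚᵘ-homo-* (ι a) (ι b) ⟨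
    ℚ.toℚᵘ (ι a ℚ.* ι b)                ∎)
  where open import Relation.Binary.Reasoning.Setoid ℚᵘ.≃-setoid

ι-mono-≤ : ∀ {a b} → a ≤ b → ι a ℚ.≤ ι b
ι-mono-≤ {a} {b} a≤b = ℚ.toℚᵘ-cancel-≤ (ℚᵘ.≤-respʳ-≃ (ℚᵘ.≃-sym (ι-toℚᵘ b))
  (ℚᵘ.≤-respˡ-≃ (ℚᵘ.≃-sym (ι-toℚᵘ a)) (*≤* (ℤ.*-monoʳ-≤-nonNeg 1ℤ a≤b))))

ι-injective : ∀ {a b} → ι a ≡ ι b → a ≡ b
ι-injective {a} {b} eq
  with *≡* a*1≡b*1 ← ℚᵘ.≃-trans (ℚᵘ.≃-sym (ι-toℚᵘ a)) (ℚᵘ.≃-trans (ℚᵘ.≃-reflexive (cong ℚ.toℚᵘ eq)) (ι-toℚᵘ b))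
  = trans (sym (ℤ.*-identityʳ a)) (trans a*1≡b*1 (ℤ.*-identityʳ b))

p+q≡0⇒p≡0 : ∀ {p q} → 0ℚ ℚ.≤ p → 0ℚ ℚ.≤ q → p ℚ.+ q ≡ 0ℚ → p ≡ 0ℚ
p+q≡0⇒p≡0 {p} {q} 0≤p 0≤q p+q≡0 = ℚ.≤-antisym
  (subst (p ℚ.≤_) p+q≡0 (subst (ℚ._≤ p ℚ.+ q) (ℚ.+-identityʳ p) (ℚ.+-monoʳ-≤ p 0≤q))) 0≤p

p*q≡0⇒q≡0 : ∀ {p q} → 0ℚ ℚ.≤ p → p ≢ 0ℚ → 0ℚ ℚ.≤ q → p ℚ.* q ≡ 0ℚ → q ≡ 0ℚ
p*q≡0⇒q≡0 {p} {q} 0≤p p≢0 0≤q pq≡0 = ℚ.≤-antisym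
  (ℚ.*-cancelˡ-≤-pos p (ℚ.≤-reflexive (trans pq≡0 (sym (ℚ.*-zeroʳ p))))) 0≤q
  where instance
    p-pos : ℚ.Positive p
    p-pos = ℚ.nonNeg∧nonZero⇒pos p {{ℚ.nonNegative 0≤p}} {{ℚ.≢-nonZero p≢0}}

sumFinℚ : ∀ {k} → (Fin k → ℚ) → ℚ
sumFinℚ {zero}  f = 0ℚ
sumFinℚ {suc k} f = f zero ℚ.+ sumFinℚ (f ∘ suc)

sumFinℚ-cong : ∀ {k} {f g : Fin k → ℚ} → (∀ i → f i ≡ g i) → sumFinℚ f ≡ sumFinℚ g
sumFinℚ-cong {zero}  f≗g = refl
sumFinℚ-cong {suc k} f≗g = cong₂ ℚ._+_ (f≗g zero) (sumFinℚ-cong (f≗g ∘ suc))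

ι-sumFin : ∀ {k} (f : Fin k → ℤ) → ι (sumFin f) ≡ sumFinℚ (ι ∘ f)
ι-sumFin {zero}  f = refl
ι-sumFin {suc k} f = trans (ι-+ (f zero) _) (cong (ι (f zero) ℚ.+_) (ι-sumFin (f ∘ suc)))

module _ where
  open CommutativeSemigroup (CommutativeMonoid.commutativeSemigroup ℚ.+-0-commutativeMonoid) using (interchange)
  open CommutativeSemigroup (CommutativeMonoid.commutativeSemigroup ℚ.*-1-commutativeMonoid) using (x∙yz≈y∙xz)

  sumFinℚ-zero : ∀ {k} (h : Fin k → ℚ) → sumFinℚ (λ i → h i ℚ.* 0ℚ) ≡ 0ℚ
  sumFinℚ-zero {zero}  h = refl
  sumFinℚ-zero {suc k} h = trans (cong₂ ℚ._+_ (ℚ.*-zeroʳ (h zero)) (sumFinℚ-zero (h ∘ suc))) (ℚ.+-identityˡ 0ℚ)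

  sumFinℚ-linear : ∀ {k} (h f g : Fin k → ℚ) α →
    sumFinℚ (λ i → h i ℚ.* (α ℚ.* f i ℚ.+ g i)) ≡ α ℚ.* sumFinℚ (λ i → h i ℚ.* f i) ℚ.+ sumFinℚ (λ i → h i ℚ.* g i)
  sumFinℚ-linear {zero}  h f g α = sym (trans (ℚ.+-identityʳ _) (ℚ.*-zeroʳ α))
  sumFinℚ-linear {suc k} h f g α = trans
    (cong₂ ℚ._+_
      (trans (ℚ.*-distribˡ-+ (h zero) (α ℚ.* f zero) (g zero))
        (cong (ℚ._+ h zero ℚ.* g zero) (x∙yz≈y∙xz (h zero) α (f zero))))
      (sumFinℚ-linear (h ∘ suc) (f ∘ suc) (g ∘ suc) α))
    (trans (interchange (α ℚ.* (h zero ℚ.* f zero)) (h zero ℚ.* g zero) _ _)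
      (cong (ℚ._+ _) (sym (ℚ.*-distribˡ-+ α (h zero ℚ.* f zero) _))))

-- Indicators of decidable propositions and step functions on ℕ

ind : {B : Set} → Dec B → ℤ
ind B? = 𝟙 (does B?)

private variable
  A B : Set

ind-yes : (B? : Dec B) → B → ind B? ≡ 1ℤ
ind-yes (yes _) b = refl
ind-yes (no ¬b) b = contradiction b ¬b

ind-no : (B? : Dec B) → ¬ B → ind B? ≡ 0ℤ
ind-no (yes b) ¬b = contradiction b ¬b
ind-no (no _)  ¬b = refl

ind-nonNeg : (B? : Dec B) → 0ℤ ≤ ind B?
ind-nonNeg (yes _) = ℤ.+≤+ ℕ.z≤n
ind-nonNeg (no _)  = ℤ.≤-refl

ind-zero : (B? : Dec B) → ind B? ≡ 0ℤ → ¬ B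
ind-zero B? eq b with () ← trans (sym eq) (ind-yes B? b)

ind-difference-nonNeg : (A? : Dec A) (B? : Dec B) → (B → A) → 0ℤ ≤ ind A? - ind B?
ind-difference-nonNeg A? (yes b) B⇒A = ℤ.≤-reflexive (cong (_- 1ℤ) (sym (ind-yes A? (B⇒A b))))
ind-difference-nonNeg A? (no _)  B⇒A = subst (0ℤ ≤_) (sym (ℤ.+-identityʳ (ind A?))) (ind-nonNeg A?)

ind-difference-sound : (A? : Dec A) (B? : Dec B) → (B → A) → (A → B) → ind A? - ind B? ≡ 0ℤ
ind-difference-sound A? (yes b) B⇒A A⇒B = cong (_- 1ℤ) (ind-yes A? (B⇒A b))
ind-difference-sound A? (no ¬b) B⇒A A⇒B = trans (ℤ.+-identityʳ (ind A?)) (ind-no A? (¬b ∘ A⇒B))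

ind-difference-complete : (A? : Dec A) (B? : Dec B) → ind A? - ind B? ≡ 0ℤ → A → B
ind-difference-complete A? (yes b) eq a = b
ind-difference-complete A? (no _)  eq a = contradiction a (ind-zero A? (trans (sym (ℤ.+-identityʳ (ind A?))) eq))

lt : ℕ → ℕ → ℤ
lt m k = 𝟙 (m <ᵇ k)

lt-sucʳ : ∀ m k → lt m (suc k) - lt m k ≡ ind (m ℕ.≟ k)
lt-sucʳ zero    zero    = refl
lt-sucʳ zero    (suc k) = refl
lt-sucʳ (suc m) zero    = refl
lt-sucʳ (suc m) (suc k) = lt-sucʳ m k

lt-sucˡ : ∀ m k → lt m k - lt (suc m) k ≡ ind (suc m ℕ.≟ k)
lt-sucˡ m zero    = refl
lt-sucˡ m (suc k) = lt-sucʳ m k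

-- Arcs of the key graph as matches of endpoints

module KeyGraph {n : ℕ} (ℓ r : Fin n → ℕ) (repr : IsRepr ℓ r) where

  Vertex : Set
  Vertex = Fin n

  Ineq : Set
  Ineq = LinIneq ℓ r

  private variable
    x y z : Vertex

  -- Colours are Booleans, true for blue; loops count as red. An arc of colour c from x to y
  -- leaves x at the point out c x and reaches y at the endpoint inn c y.
  out inn : Bool → Vertex → ℕ
  out true  x = suc (r x)
  out false x = ℓ x
  inn true  y = ℓ y
  inn false y = r y

  Adj : Bool → Vertex → Vertex → Set
  Adj c x y = inn c y ≡ out c x

  -- Colour and ends determine the weight: a loop weighs as much as a red arc from a vertex to
  -- itself, the ℓ terms cancelling.
  wt : Bool → Vertex → Vertex → Ineq
  wt c     x y (ℓv i) = δ ℓ r x i - δ ℓ r y i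
  wt true  x y (ρv i) = δ ℓ r x i
  wt false x y (ρv i) = - δ ℓ r y i
  wt c     x y cst    = 𝟙 c

  weight-wt : (a : Arc ℓ r x y) → ∀ v → weight ℓ r a v ≡ wt (isBlue ℓ r a) x y v
  weight-wt (blue _) (ℓv i) = refl
  weight-wt (blue _) (ρv i) = refl
  weight-wt (blue _) cst    = refl
  weight-wt (red _)  (ℓv i) = refl
  weight-wt (red _)  (ρv i) = refl
  weight-wt (red _)  cst    = refl
  weight-wt {x} (loop _) (ℓv i) = sym (ℤ.+-inverseʳ (δ ℓ r x i))
  weight-wt (loop _) (ρv i) = refl
  weight-wt (loop _) cst    = refl

  arc-adj : (a : Arc ℓ r x y) → Adj (isBlue ℓ r a) x y
  arc-adj {x} (blue (_ , ℓy≡rx+1)) = trans ℓy≡rx+1 (ℕ.+-comm (r x) 1)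
  arc-adj (red (_ , ry≡ℓx)) = ry≡ℓx
  arc-adj (loop rx≡ℓx)      = rx≡ℓx

  -- Converse of `arc-adj`. In the red case the two intervals share the point `r y = ℓ x`, so
  -- neither precedes the other; equal ends give a loop.
  mkArc : ∀ c → Adj c x y → Σ (Arc ℓ r x y) λ a → isBlue ℓ r a ≡ c
  mkArc {x} true ℓy≡1+rx = blue (ℕ.≤-reflexive (sym ℓy≡1+rx) , trans ℓy≡1+rx (ℕ.+-comm 1 (r x))) , refl
  mkArc {x} {y} false ry≡ℓx with x ≟ y
  ... | yes refl = loop ry≡ℓx , refl
  ... | no x≢y   = red ((x≢y , x⊀y , y⊀x) , ry≡ℓx) , refl
    where
    x⊀y : ¬ r x ℕ.< ℓ y
    x⊀y rx<ℓy = ℕ.<⇒≱ rx<ℓy (ℕ.≤-trans (repr y) (ℕ.≤-trans (ℕ.≤-reflexive ry≡ℓx) (repr x)))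
    y⊀x : ¬ r y ℕ.< ℓ x
    y⊀x = ℕ.<-irrefl ry≡ℓx

  size : Cycle ℓ r → ℕ
  size C = suc (Cycle.len C)

  at : (C : Cycle ℓ r) → Fin (size C) → Vertex
  at = Cycle.vert

  colour : (C : Cycle ℓ r) → Fin (size C) → Bool
  colour C i = isBlue ℓ r (Cycle.arc C i)

  adj : (C : Cycle ℓ r) → ∀ i → Adj (colour C i) (at C i) (at C (next i))
  adj C i = arc-adj (Cycle.arc C i)

  cycleIneq-wt : ∀ C v →
    cycleIneq ℓ r C v ≡ sumFin (λ i → wt (colour C i) (at C i) (at C (next i)) v)
  cycleIneq-wt C v = sumFin-cong λ i → weight-wt (Cycle.arc C i) v

  sumIneq : List (Cycle ℓ r) → Ineq
  sumIneq []       v = 0ℤ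
  sumIneq (C ∷ Cs) v = cycleIneq ℓ r C v + sumIneq Cs v

  sumIneq-++ : ∀ Cs Ds v → sumIneq (Cs ++ Ds) v ≡ sumIneq Cs v + sumIneq Ds v
  sumIneq-++ []       Ds v = sym (ℤ.+-identityˡ _)
  sumIneq-++ (C ∷ Cs) Ds v = trans (cong (cycleIneq ℓ r C v +_) (sumIneq-++ Cs Ds v))
    (sym (ℤ.+-assoc (cycleIneq ℓ r C v) _ _))

  -- Decomposition of closed paths into cycles

  data Path : Vertex → Vertex → Set where
    []   : Path x x
    step : ∀ c → Adj c x y → Path y z → Path x z

  pathIneq : Path x y → Ineq
  pathIneq []                   v = 0ℤ
  pathIneq (step {x} {y} c _ p) v = wt c x y v + pathIneq p v

  _◅◅_ : Path x y → Path y z → Path x z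
  []         ◅◅ q = q
  step c a p ◅◅ q = step c a (p ◅◅ q)

  pathIneq-◅◅ : (p : Path x y) (q : Path y z) → ∀ v → pathIneq (p ◅◅ q) v ≡ pathIneq p v + pathIneq q v
  pathIneq-◅◅ []                   q v = sym (ℤ.+-identityˡ _)
  pathIneq-◅◅ (step {x} {y} c a p) q v = trans (cong (wt c x y v +_) (pathIneq-◅◅ p q v))
    (sym (ℤ.+-assoc (wt c x y v) _ _))

  steps : Path x y → ℕ
  steps []           = 0
  steps (step _ _ p) = suc (steps p)

  vertex : (p : Path x y) → Fin (suc (steps p)) → Vertex
  vertex {x} p            zero    = x
  vertex     (step _ _ p) (suc i) = vertex p i

  _∉_ : Vertex → Path y z → Set
  x ∉ p = ∀ i → vertex p i ≢ x

  Simple : Path x y → Set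
  Simple []               = ⊤
  Simple (step {x} _ _ p) = x ∉ p × Simple p

  simple-injective : (p : Path x y) → Simple p → ∀ i j → vertex p i ≡ vertex p j → i ≡ j
  simple-injective p            s         zero    zero    eq = refl
  simple-injective (step _ _ p) (x∉p , s) zero    (suc j) eq = contradiction (sym eq) (x∉p j)
  simple-injective (step _ _ p) (x∉p , s) (suc i) zero    eq = contradiction eq (x∉p i)
  simple-injective (step _ _ p) (x∉p , s) (suc i) (suc j) eq = cong suc (simple-injective p s i j eq)

  cutBefore : (p : Path x z) → ∀ i → Path x (vertex p i)
  cutBefore p            zero    = []
  cutBefore (step c a p) (suc i) = step c a (cutBefore p i)

  cutAfter : (p : Path x z) → ∀ i → Path (vertex p i) z
  cutAfter p            zero    = p
  cutAfter (step c a p) (suc i) = cutAfter p i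

  pathIneq-cut : (p : Path x z) → ∀ i v →
    pathIneq p v ≡ pathIneq (cutBefore p i) v + pathIneq (cutAfter p i) v
  pathIneq-cut p                    zero    v = sym (ℤ.+-identityˡ _)
  pathIneq-cut (step {x} {y} c a p) (suc i) v = trans (cong (wt c x y v +_) (pathIneq-cut p i v))
    (sym (ℤ.+-assoc (wt c x y v) _ _))

  cutBefore-vertex : (p : Path x z) → ∀ i j → ∃ λ k → vertex p k ≡ vertex (cutBefore p i) j
  cutBefore-vertex p            i       zero    = zero , refl
  cutBefore-vertex (step c a p) (suc i) (suc j) with cutBefore-vertex p i j
  ... | k , eq = suc k , eq

  cutBefore-simple : (p : Path x z) → Simple p → ∀ i → Simple (cutBefore p i)
  cutBefore-simple p                s         zero    = tt
  cutBefore-simple (step {x} _ _ p) (x∉p , s) (suc i) = x∉before , cutBefore-simple p s i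
    where
    x∉before : x ∉ cutBefore p i
    x∉before j eq with cutBefore-vertex p i j
    ... | k , eq′ = x∉p k (trans eq′ eq)

  cutAfter-simple : (p : Path x z) → Simple p → ∀ i → Simple (cutAfter p i)
  cutAfter-simple p            s       zero    = s
  cutAfter-simple (step _ _ p) (_ , s) (suc i) = cutAfter-simple p s i

  -- Index `i` stands for the arc leaving the `i`-th vertex. The last vertex has none on the path;
  -- the default here and in `target` describes the arc that is to close the path.
  stepColour : (p : Path x y) → Bool → Fin (suc (steps p)) → Bool
  stepColour []           c zero    = c
  stepColour (step c _ _) d zero    = c
  stepColour (step _ _ p) d (suc i) = stepColour p d i

  target : (p : Path x y) → Vertex → Fin (suc (steps p)) → Vertex
  target p w i = redirect w (vertex p ∘ suc) (next i)

  target-suc : ∀ c (a : Adj c x y) (p : Path y z) w i → target (step c a p) w (suc i) ≡ target p w i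
  target-suc c a p w i = redirect-next w (vertex p) i

  step-adj : (p : Path x y) → ∀ c w → Adj c y w →
    ∀ i → Adj (stepColour p c i) (vertex p i) (target p w i)
  step-adj []           d w b zero    = b
  step-adj (step c a p) d w b zero    = a
  step-adj (step c a p) d w b (suc i) =
    subst (Adj (stepColour p d i) (vertex p i)) (sym (target-suc c a p w i)) (step-adj p d w b i)

  step-sum : (p : Path x y) → ∀ c w v →
    sumFin (λ i → wt (stepColour p c i) (vertex p i) (target p w i) v) ≡ pathIneq p v + wt c y w v
  step-sum {x} []               c w v = ℤ.+-comm (wt c x w v) 0ℤ
  step-sum {y = z} (step {x} {y} d a p) c w v = trans
    (cong (wt d x y v +_) (trans
      (sumFin-cong λ i → cong (λ u → wt (stepColour p c i) (vertex p i) u v) (target-suc d a p w i))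
      (step-sum p c w v)))
    (sym (ℤ.+-assoc (wt d x y v) _ _))

  closeUp : ∀ c → Adj c x y → (p : Path y x) → Simple p →
    Σ (Cycle ℓ r) λ C → ∀ v → cycleIneq ℓ r C v ≡ wt c x y v + pathIneq p v
  closeUp {x} {y} c b p s = C , λ v → begin
      cycleIneq ℓ r C v
        ≡⟨ cycleIneq-wt C v ⟩
      sumFin (λ i → wt (colour C i) (vertex p i) (vertex p (next i)) v)
        ≡⟨ sumFin-cong (λ i → cong₂ (λ d u → wt d (vertex p i) u v) (proj₂ (arcs i))
             (sym (redirect-eta (vertex p) (next i)))) ⟩
      sumFin (λ i → wt (stepColour p c i) (vertex p i) (target p y i) v)
        ≡⟨ step-sum p c y v ⟩
      pathIneq p v + wt c x y v
        ≡⟨ ℤ.+-comm (pathIneq p v) _ ⟩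
      wt c x y v + pathIneq p v ∎
    where
    open ≡-Reasoning
    arcs : ∀ i → Σ (Arc ℓ r (vertex p i) (vertex p (next i))) λ a → isBlue ℓ r a ≡ stepColour p c i
    arcs i = mkArc (stepColour p c i)
      (subst (Adj (stepColour p c i) (vertex p i)) (redirect-eta (vertex p) (next i)) (step-adj p c y b i))
    C : Cycle ℓ r
    C = record
      { len  = steps p
      ; vert = vertex p
      ; inj  = simple-injective p s
      ; arc  = λ i → proj₁ (arcs i)
      }

  -- Loops are erased from the end of the path. If a new source `x` already lies on the simple
  -- remainder `q`, the part of `q` up to `x`, closed by the new arc, is a cycle to be stored, and
  -- the rest of `q` remains.
  eraseLoops : (p : Path x y) → Σ (Path x y) λ q → Simple q × Σ (List (Cycle ℓ r)) λ Cs →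
    ∀ v → pathIneq p v ≡ pathIneq q v + sumIneq Cs v
  eraseLoops [] = [] , tt , [] , λ v → refl
  eraseLoops (step {x} {y} c a p) with eraseLoops p
  ... | q , s , Cs , eq with any? (λ i → vertex q i ≟ x)
  ... | no x∉q = step c a q , ((λ i qi≡x → x∉q (i , qi≡x)) , s) , Cs ,
    λ v → trans (cong (wt c x y v +_) (eq v)) (sym (ℤ.+-assoc (wt c x y v) _ _))
  ... | yes (i , refl) with closeUp c a (cutBefore q i) (cutBefore-simple q s i)
  ... | C , C-eq = cutAfter q i , cutAfter-simple q s i , C ∷ Cs , λ v → trans
    (cong (wt c x y v +_) (trans (eq v) (cong (_+ sumIneq Cs v) (pathIneq-cut q i v))))
    (trans (rearrange (wt c x y v) (pathIneq (cutBefore q i) v) (pathIneq (cutAfter q i) v) (sumIneq Cs v))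
      (cong (λ e → pathIneq (cutAfter q i) v + (e + sumIneq Cs v)) (sym (C-eq v))))
    where
    rearrange : ∀ a b c d → a + ((b + c) + d) ≡ c + ((a + b) + d)
    rearrange = solve-∀

  -- Keeping `first` apart records that there is at least one cycle, so two decompositions together
  -- have at least two.
  record Decomposition (W : Ineq) : Set where
    constructor decomposition
    field
      first : Cycle ℓ r
      rest  : List (Cycle ℓ r)
      sum-≡ : ∀ v → W v ≡ sumIneq (first ∷ rest) v

  decompose : ∀ c → Adj c x y → (p : Path y x) → Decomposition (λ v → wt c x y v + pathIneq p v)
  decompose {x} {y} c a p with eraseLoops p
  ... | q , s , Cs , eq with closeUp c a q s
  ... | C , C-eq = decomposition C Cs λ v → trans (cong (wt c x y v +_) (eq v))
    (trans (sym (ℤ.+-assoc (wt c x y v) _ _)) (cong (_+ sumIneq Cs v) (sym (C-eq v))))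

  -- Coefficients and the weak order

  δ-refl : ∀ x → δ ℓ r x x ≡ 1ℤ
  δ-refl x with x ≟ x
  ... | yes _  = refl
  ... | no x≢x = contradiction refl x≢x

  δ-≢ : x ≢ y → δ ℓ r x y ≡ 0ℤ
  δ-≢ {x} {y} x≢y with x ≟ y
  ... | yes x≡y = contradiction x≡y x≢y
  ... | no _    = refl

  δ-nonNeg : ∀ x y → 0ℤ ≤ δ ℓ r x y
  δ-nonNeg x y with x ≟ y
  ... | yes _ = ℤ.+≤+ ℕ.z≤n
  ... | no _  = ℤ.≤-refl

  sumFin-δ : ∀ x → sumFin (δ ℓ r x) ≡ 1ℤ
  sumFin-δ x = trans (sumFin-pick (δ ℓ r x) x λ y y≢x → δ-≢ (y≢x ∘ sym)) (δ-refl x)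

  -- Coefficient contributed by a vertex entered by colour c and left by colour d.
  turn : Bool → Bool → ℤ
  turn c d = 𝟙 d - 𝟙 (not c)

  -- The vertices `u` may repeat: replacing two turning vertices by the same one leads from a cycle
  -- to such a walk.
  walkIneq : ∀ {m} → (Fin (suc m) → Bool) → (Fin (suc m) → Vertex) → Ineq
  walkIneq c u v = sumFin λ i → wt (c i) (u i) (u (next i)) v

  walkIneq-ℓ : ∀ {m} (c : Fin (suc m) → Bool) u x → walkIneq c u (ℓv x) ≡ 0ℤ
  walkIneq-ℓ c u x = trans
    (sumFin-- (λ i → δ ℓ r (u i) x) (λ i → δ ℓ r (u (next i)) x))
    (trans (cong (λ s → sumFin (λ i → δ ℓ r (u i) x) - s) (sumFin-next (λ i → δ ℓ r (u i) x)))
      (ℤ.+-inverseʳ (sumFin λ i → δ ℓ r (u i) x)))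

  -- A blue arc contributes at its source, a red one at its target. Shifting the source terms by
  -- `next` brings together the arcs entering and leaving the same vertex.
  walkIneq-ρ : ∀ {m} (c : Fin (suc m) → Bool) u x →
    walkIneq c u (ρv x) ≡ sumFin (λ i → turn (c i) (c (next i)) * δ ℓ r (u (next i)) x)
  walkIneq-ρ {m} c u x = begin
      sumFin (λ i → wt (c i) (u i) (u (next i)) (ρv x))
        ≡⟨ sumFin-cong (λ i → wt-ρ (c i) (u i) (u (next i))) ⟩
      sumFin (λ i → leave i - enter i)
        ≡⟨ sumFin-- leave enter ⟩
      sumFin leave - sumFin enter
        ≡⟨ cong (_- sumFin enter) (sym (sumFin-next leave)) ⟩
      sumFin (leave ∘ next) - sumFin enter
        ≡⟨ sym (sumFin-- (leave ∘ next) enter) ⟩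
      sumFin (λ i → leave (next i) - enter i)
        ≡⟨ sumFin-cong (λ i → factor (𝟙 (c (next i))) (𝟙 (not (c i))) (δ ℓ r (u (next i)) x)) ⟩
      sumFin (λ i → turn (c i) (c (next i)) * δ ℓ r (u (next i)) x) ∎
    where
    open ≡-Reasoning
    leave enter : Fin (suc m) → ℤ
    leave i = 𝟙 (c i) * δ ℓ r (u i) x
    enter i = 𝟙 (not (c i)) * δ ℓ r (u (next i)) x
    wt-ρ : ∀ b y z → wt b y z (ρv x) ≡ 𝟙 b * δ ℓ r y x - 𝟙 (not b) * δ ℓ r z x
    wt-ρ true  y z = sym (trans (ℤ.+-identityʳ _) (ℤ.*-identityˡ (δ ℓ r y x)))
    wt-ρ false y z = sym (trans (ℤ.+-identityˡ _) (cong -_ (ℤ.*-identityˡ (δ ℓ r z x))))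
    factor : ∀ a b d → a * d - b * d ≡ (a - b) * d
    factor = solve-∀

  turn-≢ : ∀ c d → c ≢ d → turn c d ≡ 0ℤ
  turn-≢ true  true  c≢d = contradiction refl c≢d
  turn-≢ true  false c≢d = refl
  turn-≢ false true  c≢d = refl
  turn-≢ false false c≢d = contradiction refl c≢d

  -- Where the colour changes, `turn` is 0 and the ℓ terms telescope, so such a vertex can be
  -- renamed freely.
  walkIneq-cong : ∀ {m} (c : Fin (suc m) → Bool) u u′ →
    (∀ i → c i ≡ c (next i) → u (next i) ≡ u′ (next i)) → ∀ v → walkIneq c u v ≡ walkIneq c u′ v
  walkIneq-cong c u u′ u≗u′ (ℓv x) = trans (walkIneq-ℓ c u x) (sym (walkIneq-ℓ c u′ x))
  walkIneq-cong c u u′ u≗u′ cst    = refl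
  walkIneq-cong c u u′ u≗u′ (ρv x) = trans (walkIneq-ρ c u x)
    (trans (sumFin-cong same) (sym (walkIneq-ρ c u′ x)))
    where
    same : ∀ i → turn (c i) (c (next i)) * δ ℓ r (u (next i)) x ≡ turn (c i) (c (next i)) * δ ℓ r (u′ (next i)) x
    same i with c i Bool.≟ c (next i)
    ... | yes ci≡ = cong (λ y → turn (c i) (c (next i)) * δ ℓ r y x) (u≗u′ i ci≡)
    ... | no  ci≢ = trans (cong (_* δ ℓ r (u (next i)) x) (turn-≢ _ _ ci≢))
                     (cong (_* δ ℓ r (u′ (next i)) x) (sym (turn-≢ _ _ ci≢)))

  coeff : Cycle ℓ r → Vertex → ℤ
  coeff C x = cycleIneq ℓ r C (ρv x)

  turnAt : (C : Cycle ℓ r) → Fin (size C) → ℤ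
  turnAt C i = turn (colour C i) (colour C (next i))

  cycleIneq-ℓ : ∀ C x → cycleIneq ℓ r C (ℓv x) ≡ 0ℤ
  cycleIneq-ℓ C x = trans (cycleIneq-wt C (ℓv x)) (walkIneq-ℓ (colour C) (at C) x)

  coeff-turn : ∀ C x → coeff C x ≡ sumFin (λ i → turnAt C i * δ ℓ r (at C (next i)) x)
  coeff-turn C x = trans (cycleIneq-wt C (ρv x)) (walkIneq-ρ (colour C) (at C) x)

  sum-at : ∀ C (f : Fin (size C) → ℤ) i →
    sumFin (λ j → f j * δ ℓ r (at C (next j)) (at C (next i))) ≡ f i
  sum-at C f i = trans
    (sumFin-pick _ i λ j j≢i → trans
      (cong (f j *_) (δ-≢ λ eq → j≢i (next-injective (Cycle.inj C _ _ eq)))) (ℤ.*-zeroʳ (f j)))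
    (trans (cong (f i *_) (δ-refl (at C (next i)))) (ℤ.*-identityʳ (f i)))

  sum-away : ∀ C (f : Fin (size C) → ℤ) x → (∀ i → at C (next i) ≡ x → f i ≡ 0ℤ) →
    sumFin (λ j → f j * δ ℓ r (at C (next j)) x) ≡ 0ℤ
  sum-away C f x f≡0 = sumFin-0 zeros
    where
    zeros : ∀ j → f j * δ ℓ r (at C (next j)) x ≡ 0ℤ
    zeros j with at C (next j) ≟ x
    ... | yes eq = trans (ℤ.*-identityʳ (f j)) (f≡0 j eq)
    ... | no  _  = ℤ.*-zeroʳ (f j)

  coeff-at : ∀ C i → coeff C (at C (next i)) ≡ turnAt C i
  coeff-at C i = trans (coeff-turn C (at C (next i))) (sum-at C (turnAt C) i)

  coeff-away : ∀ C x → (∀ i → at C (next i) ≡ x → turnAt C i ≡ 0ℤ) → coeff C x ≡ 0ℤ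
  coeff-away C x turns≡0 = trans (coeff-turn C x) (sum-away C (turnAt C) x turns≡0)

  sum-over-vertices : ∀ C (f : Fin (size C) → ℤ) →
    sumFin (λ x → sumFin (λ i → f i * δ ℓ r (at C (next i)) x)) ≡ sumFin f
  sum-over-vertices C f = trans (sumFin-swap λ x i → f i * δ ℓ r (at C (next i)) x)
    (sumFin-cong λ i → trans (sumFin-*ˡ (f i) (δ ℓ r (at C (next i))))
      (trans (cong (f i *_) (sumFin-δ (at C (next i)))) (ℤ.*-identityʳ (f i))))

  sum-coeff : ∀ C → sumFin (coeff C) ≡ sumFin (turnAt C)
  sum-coeff C = trans (sumFin-cong (coeff-turn C)) (sum-over-vertices C (turnAt C))

  γ-cst : ∀ C → pos (γ ℓ r C) ≡ cycleIneq ℓ r C cst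
  γ-cst C = trans (countFin-sum (colour C)) (sym (cycleIneq-wt C cst))

  -- A cycle visits a vertex at most once, so coefficients are 1, 0 or -1 and the positive part is
  -- the indicator of the set A. Hence `sizeA` depends on the inequality alone and is monotone in
  -- the coefficients.
  sizeA-coeff : ∀ C → pos (sizeA ℓ r C) ≡ sumFin (λ x → coeff C x ⊔ 0ℤ)
  sizeA-coeff C = begin
      pos (sizeA ℓ r C)
        ≡⟨ countFin-sum (λ i → colour C i ∧ colour C (next i)) ⟩
      sumFin (λ i → 𝟙 (colour C i ∧ colour C (next i)))
        ≡⟨ sumFin-cong (λ i → both-blue (colour C i) (colour C (next i))) ⟩
      sumFin (λ i → turnAt C i ⊔ 0ℤ)
        ≡⟨ sym (sum-over-vertices C (λ i → turnAt C i ⊔ 0ℤ)) ⟩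
      sumFin (λ x → sumFin (λ i → (turnAt C i ⊔ 0ℤ) * δ ℓ r (at C (next i)) x))
        ≡⟨ sumFin-cong positive-part ⟩
      sumFin (λ x → coeff C x ⊔ 0ℤ) ∎
    where
    open ≡-Reasoning
    both-blue : ∀ c d → 𝟙 (c ∧ d) ≡ turn c d ⊔ 0ℤ
    both-blue true  true  = refl
    both-blue true  false = refl
    both-blue false true  = refl
    both-blue false false = refl
    positive-part : ∀ x → sumFin (λ i → (turnAt C i ⊔ 0ℤ) * δ ℓ r (at C (next i)) x) ≡ coeff C x ⊔ 0ℤ
    positive-part x with any? (λ i → at C (next i) ≟ x)
    ... | yes (i , refl) = trans (sum-at C (λ j → turnAt C j ⊔ 0ℤ) i) (cong (_⊔ 0ℤ) (sym (coeff-at C i)))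
    ... | no x∉C = trans (sum-away C (λ j → turnAt C j ⊔ 0ℤ) x λ i eq → contradiction (i , eq) x∉C)
      (cong (_⊔ 0ℤ) (sym (coeff-away C x λ i eq → contradiction (i , eq) x∉C)))

  sizeA-sizeB : ∀ C → pos (sizeA ℓ r C) - pos (sizeB ℓ r C) ≡ sumFin (coeff C)
  sizeA-sizeB C = begin
      pos (sizeA ℓ r C) - pos (sizeB ℓ r C)
        ≡⟨ cong₂ _-_ (countFin-sum blues) (countFin-sum reds) ⟩
      sumFin (𝟙 ∘ blues) - sumFin (𝟙 ∘ reds)
        ≡⟨ sym (sumFin-- (𝟙 ∘ blues) (𝟙 ∘ reds)) ⟩
      sumFin (λ i → 𝟙 (blues i) - 𝟙 (reds i))
        ≡⟨ sumFin-cong (λ i → difference (Cycle.arc C i) (Cycle.arc C (next i))) ⟩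
      sumFin (turnAt C)
        ≡⟨ sym (sum-coeff C) ⟩
      sumFin (coeff C) ∎
    where
    open ≡-Reasoning
    blues reds : Fin (size C) → Bool
    blues i = isBlue ℓ r (Cycle.arc C i) ∧ isBlue ℓ r (Cycle.arc C (next i))
    reds  i = isRed ℓ r (Cycle.arc C i) ∧ isRed ℓ r (Cycle.arc C (next i))
    difference : ∀ {x y x′ y′} (a : Arc ℓ r x y) (b : Arc ℓ r x′ y′) →
      𝟙 (isBlue ℓ r a ∧ isBlue ℓ r b) - 𝟙 (isRed ℓ r a ∧ isRed ℓ r b) ≡ turn (isBlue ℓ r a) (isBlue ℓ r b)
    difference (blue _) (blue _) = refl
    difference (blue _) (red _)  = refl
    difference (blue _) (loop _) = refl
    difference (red _)  (blue _) = refl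
    difference (red _)  (red _)  = refl
    difference (red _)  (loop _) = refl
    difference (loop _) (blue _) = refl
    difference (loop _) (red _)  = refl
    difference (loop _) (loop _) = refl

  -- All three quantities compared by the weak order can be read off the coefficients.
  Equiv⇒¬WeakSmaller : ∀ {C D} → Equiv ℓ r (cycleIneq ℓ r D) (cycleIneq ℓ r C) → ¬ WeakSmaller ℓ r D C
  Equiv⇒¬WeakSmaller {C} {D} D≈C = λ
    { (inj₁ γ<)                   → ℕ.<-irrefl γ≡ γ<
    ; (inj₂ (inj₁ (_ , A<)))      → ℕ.<-irrefl (sym A≡) A<
    ; (inj₂ (inj₂ (_ , _ , B<)))  → ℕ.<-irrefl B≡ B<
    }
    where
    γ≡ : γ ℓ r D ≡ γ ℓ r C
    γ≡ = ℤ.+-injective (trans (γ-cst D) (trans (D≈C cst) (sym (γ-cst C))))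
    A≡ : sizeA ℓ r D ≡ sizeA ℓ r C
    A≡ = ℤ.+-injective (trans (sizeA-coeff D)
      (trans (sumFin-cong λ x → cong (_⊔ 0ℤ) (D≈C (ρv x))) (sym (sizeA-coeff C))))
    cancel : ∀ a b → a - (a - b) ≡ b
    cancel = solve-∀
    B≡ : sizeB ℓ r D ≡ sizeB ℓ r C
    B≡ = ℤ.+-injective (trans (sym (cancel (pos (sizeA ℓ r D)) _)) (trans
      (cong₂ _-_ (cong pos A≡)
        (trans (sizeA-sizeB D) (trans (sumFin-cong (D≈C ∘ ρv)) (sym (sizeA-sizeB C)))))
      (cancel (pos (sizeA ℓ r C)) _)))

  γ-nonNeg : ∀ Cs → 0ℤ ≤ sumIneq Cs cst
  γ-nonNeg []       = ℤ.≤-refl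
  γ-nonNeg (C ∷ Cs) = ℤ.+-mono-≤ (subst (0ℤ ≤_) (γ-cst C) (ℤ.+≤+ ℕ.z≤n)) (γ-nonNeg Cs)

  γ-zero : ∀ C Cs → sumIneq (C ∷ Cs) cst ≡ 0ℤ → cycleIneq ℓ r C cst ≡ 0ℤ × sumIneq Cs cst ≡ 0ℤ
  γ-zero C Cs eq = a+b≡0⇒a≡0 0≤C (γ-nonNeg Cs) eq ,
    a+b≡0⇒a≡0 (γ-nonNeg Cs) 0≤C (trans (ℤ.+-comm (sumIneq Cs cst) _) eq)
    where
    0≤C : 0ℤ ≤ cycleIneq ℓ r C cst
    0≤C = subst (0ℤ ≤_) (γ-cst C) (ℤ.+≤+ ℕ.z≤n)

  all-red : ∀ C → cycleIneq ℓ r C cst ≡ 0ℤ → ∀ i → colour C i ≡ false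
  all-red C γ≡0 i = 𝟙-zero (sumFin≡0 (𝟙-nonNeg ∘ colour C) (trans (sym (cycleIneq-wt C cst)) γ≡0) i)
    where
    𝟙-nonNeg : ∀ b → 0ℤ ≤ 𝟙 b
    𝟙-nonNeg true  = ℤ.+≤+ ℕ.z≤n
    𝟙-nonNeg false = ℤ.≤-refl
    𝟙-zero : ∀ {b} → 𝟙 b ≡ 0ℤ → b ≡ false
    𝟙-zero {false} eq = refl

  turn-red : ∀ C → cycleIneq ℓ r C cst ≡ 0ℤ → ∀ i → turnAt C i ≡ - 1ℤ
  turn-red C γ≡0 i = cong₂ turn (all-red C γ≡0 i) (all-red C γ≡0 (next i))

  red-coeff : ∀ C → cycleIneq ℓ r C cst ≡ 0ℤ → ∀ x → coeff C x ≤ 0ℤ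
  red-coeff C γ≡0 x = subst (_≤ 0ℤ) (sym (coeff-turn C x)) (sumFin-nonPos
    λ i → subst (λ t → t * δ ℓ r (at C (next i)) x ≤ 0ℤ) (sym (turn-red C γ≡0 i))
      (subst (_≤ 0ℤ) (sym (ℤ.-1*i≡-i _)) (ℤ.neg-mono-≤ (δ-nonNeg (at C (next i)) x))))

  red-sum-coeff : ∀ C → cycleIneq ℓ r C cst ≡ 0ℤ → sumFin (coeff C) ℤ.< 0ℤ
  red-sum-coeff C γ≡0 = subst (ℤ._< 0ℤ) (sym (trans (sum-coeff C) (sumFin-cong (turn-red C γ≡0))))
    (ℤ.+-mono-<-≤ (ℤ.-<+ {0} {0}) (sumFin-nonPos {Cycle.len C} {λ _ → - 1ℤ} λ _ → ℤ.-≤+))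

  red-coeffs : ∀ Cs → sumIneq Cs cst ≡ 0ℤ → ∀ x → sumIneq Cs (ρv x) ≤ 0ℤ
  red-coeffs []       γ≡0 x = ℤ.≤-refl
  red-coeffs (C ∷ Cs) γ≡0 x = ℤ.+-mono-≤
    (red-coeff C (proj₁ (γ-zero C Cs γ≡0)) x) (red-coeffs Cs (proj₂ (γ-zero C Cs γ≡0)) x)

  red-sum-coeffs : ∀ C Cs → sumIneq (C ∷ Cs) cst ≡ 0ℤ → sumFin (sumIneq (C ∷ Cs) ∘ ρv) ℤ.< 0ℤ
  red-sum-coeffs C Cs γ≡0 = subst (ℤ._< 0ℤ) (sym (sumFin-+ (coeff C) (sumIneq Cs ∘ ρv)))
    (ℤ.+-mono-<-≤ (red-sum-coeff C (proj₁ (γ-zero C Cs γ≡0)))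
      (sumFin-nonPos (red-coeffs Cs (proj₂ (γ-zero C Cs γ≡0)))))

  -- If the remainder `E ∷ Es` has a blue arc, γ decides. Otherwise its coefficients are nonpositive
  -- with negative sum, so `C` has coefficients at most those of `D` and hence no larger A; if the
  -- sizes of A agree, the smaller coefficient sum of `C` means a larger B.
  summand-smaller : ∀ C D E Es → (∀ v → cycleIneq ℓ r C v ≡ cycleIneq ℓ r D v + sumIneq (E ∷ Es) v) →
    WeakSmaller ℓ r D C
  summand-smaller C D E Es eq with sumIneq (E ∷ Es) cst ℤ.≟ 0ℤ
  ... | no γ≢0 = inj₁ (ℤ.drop‿+<+ (subst₂ ℤ._<_ (trans (ℤ.+-identityʳ _) (sym (γ-cst D)))
      (trans (sym (eq cst)) (sym (γ-cst C)))
      (ℤ.+-monoʳ-< (cycleIneq ℓ r D cst) (ℤ.≤∧≢⇒< (γ-nonNeg (E ∷ Es)) (γ≢0 ∘ sym)))))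
  ... | yes γ≡0 = inj₂ (by-sizes (ℕ.m≤n⇒m<n∨m≡n A≤))
    where
    γ≡ : γ ℓ r D ≡ γ ℓ r C
    γ≡ = ℤ.+-injective (trans (γ-cst D) (trans (sym (trans (eq cst)
      (trans (cong (cycleIneq ℓ r D cst +_) γ≡0) (ℤ.+-identityʳ _)))) (sym (γ-cst C))))
    A≤ : sizeA ℓ r C ℕ.≤ sizeA ℓ r D
    A≤ = ℤ.drop‿+≤+ (subst₂ _≤_ (sym (sizeA-coeff C)) (sym (sizeA-coeff D))
      (sumFin-mono λ x → ℤ.⊔-monoˡ-≤ 0ℤ (subst₂ _≤_ (sym (eq (ρv x))) (ℤ.+-identityʳ _)
        (ℤ.+-monoʳ-≤ (coeff D x) (red-coeffs (E ∷ Es) γ≡0 x)))))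
    sums< : sumFin (coeff C) ℤ.< sumFin (coeff D)
    sums< = subst₂ ℤ._<_
      (sym (trans (sumFin-cong (eq ∘ ρv)) (sumFin-+ (coeff D) (sumIneq (E ∷ Es) ∘ ρv)))) (ℤ.+-identityʳ _)
      (ℤ.+-monoʳ-< (sumFin (coeff D)) (red-sum-coeffs E Es γ≡0))
    cancel : ∀ a b → a - b + (b - a) ≡ 0ℤ
    cancel = solve-∀
    by-sizes : sizeA ℓ r C ℕ.< sizeA ℓ r D ⊎ sizeA ℓ r C ≡ sizeA ℓ r D → _
    by-sizes (inj₁ A<) = inj₁ (γ≡ , A<)
    by-sizes (inj₂ A≡) = inj₂ (γ≡ , sym A≡ , ℕ.≰⇒> λ B≤ → ℤ.<⇒≱ sums<
      (subst₂ _≤_ (sizeA-sizeB D) (sizeA-sizeB C)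
        (ℤ.+-mono-≤ (ℤ.≤-reflexive (cong pos (sym A≡))) (ℤ.neg-mono-≤ (ℤ.+≤+ B≤)))))

  -- `Ds` collects the summands already treated, so that each summand is compared with the nonempty
  -- remainder of the same total.
  summands-smaller : ∀ C Ds Es → 2 ℕ.≤ length Ds ℕ.+ length Es →
    (∀ v → cycleIneq ℓ r C v ≡ sumIneq Ds v + sumIneq Es v) →
    All (λ p → WeakSmaller ℓ r (proj₂ p) C) (map (λ E → 1 , E) Es)
  summands-smaller C Ds []       2≤ eq = []
  summands-smaller C Ds (E ∷ Es) 2≤ eq = head Ds Es 2≤ eq ∷
    summands-smaller C (E ∷ Ds) Es (subst (2 ℕ.≤_) (ℕ.+-suc (length Ds) (length Es)) 2≤)
      (λ v → trans (eq v) (move (sumIneq Ds v) (cycleIneq ℓ r E v) (sumIneq Es v)))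
    where
    move : ∀ a b c → a + (b + c) ≡ (b + a) + c
    move = solve-∀
    head : ∀ Ds Es → 2 ℕ.≤ length Ds ℕ.+ suc (length Es) →
      (∀ v → cycleIneq ℓ r C v ≡ sumIneq Ds v + sumIneq (E ∷ Es) v) → WeakSmaller ℓ r E C
    head []       []       (ℕ.s≤s ()) eq
    head []       (F ∷ Es) 2≤ eq = summand-smaller C E F Es λ v → trans (eq v) (ℤ.+-identityˡ _)
    head (D ∷ Ds) Es       2≤ eq = summand-smaller C E D (Ds ++ Es) λ v → trans (eq v)
      (trans (move′ (cycleIneq ℓ r D v) (sumIneq Ds v) (cycleIneq ℓ r E v) (sumIneq Es v))
        (cong (λ s → cycleIneq ℓ r E v + (cycleIneq ℓ r D v + s)) (sym (sumIneq-++ Ds Es v))))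
      where
      move′ : ∀ a b c d → (a + b) + (c + d) ≡ c + (a + (b + d))
      move′ = solve-∀

  sumℕ-ones : ∀ Cs v → sumℕ ℓ r (map (λ E → 1 , E) Cs) v ≡ sumIneq Cs v
  sumℕ-ones []       v = refl
  sumℕ-ones (C ∷ Cs) v = cong₂ _+_ (ℤ.*-identityˡ (cycleIneq ℓ r C v)) (sumℕ-ones Cs v)

  sum-of-two : ∀ C {W W′} → Decomposition W → Decomposition W′ →
    (∀ v → cycleIneq ℓ r C v ≡ W v + W′ v) → IntCombSmaller ℓ r C
  sum-of-two C (decomposition D Ds D-eq) (decomposition E Es E-eq) eq =
    map (λ F → 1 , F) Fs ,
    summands-smaller C [] Fs
      (ℕ.s≤s (subst (1 ℕ.≤_) (sym (trans (length-++ Ds) (ℕ.+-suc _ _))) (ℕ.s≤s ℕ.z≤n)))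
      (λ v → trans (Fs-eq v) (sym (ℤ.+-identityˡ _))) ,
    λ v → trans (Fs-eq v) (sym (sumℕ-ones Fs v))
    where
    Fs = D ∷ (Ds ++ E ∷ Es)
    Fs-eq : ∀ v → cycleIneq ℓ r C v ≡ sumIneq Fs v
    Fs-eq v = trans (eq v) (trans (cong₂ _+_ (D-eq v) (E-eq v)) (sym (sumIneq-++ (D ∷ Ds) (E ∷ Es) v)))

  -- Splitting a cycle

  module Walk {m} (c : Fin (suc m) → Bool) (u : Fin (suc m) → Vertex)
    (a : ∀ i → Adj (c i) (u i) (u (next i))) where

    segment : ∀ {s t} → s ≤′ t → Path (u (orbit s)) (u (orbit t))
    segment (≤′-reflexive refl) = []
    segment (≤′-step {t} s≤t)   = segment s≤t ◅◅ step (c (orbit t)) (a (orbit t)) []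

    stepIneq : ℕ → Ineq
    stepIneq t v = wt (c (orbit t)) (u (orbit t)) (u (orbit (suc t))) v

    segment-sum : ∀ {s t} (s≤t : s ≤′ t) v →
      sumℕ< t (λ k → stepIneq k v) ≡ pathIneq (segment s≤t) v + sumℕ< s (λ k → stepIneq k v)
    segment-sum (≤′-reflexive refl)  v = sym (ℤ.+-identityˡ _)
    segment-sum {s} (≤′-step {t} s≤t) v = begin
        sumℕ< t w + w t                              ≡⟨ cong (_+ w t) (segment-sum s≤t v) ⟩
        pathIneq (segment s≤t) v + sumℕ< s w + w t   ≡⟨ rearrange (pathIneq (segment s≤t) v) _ _ ⟩
        pathIneq (segment s≤t) v + (w t + 0ℤ) + sumℕ< s w
          ≡⟨ cong (_+ sumℕ< s w) (sym (pathIneq-◅◅ (segment s≤t) _ v)) ⟩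
        pathIneq (segment (≤′-step s≤t)) v + sumℕ< s w ∎
      where
      open ≡-Reasoning
      w : ℕ → ℤ
      w k = stepIneq k v
      rearrange : ∀ a b c → (a + b) + c ≡ (a + (c + 0ℤ)) + b
      rearrange = solve-∀

    -- This covers both kinds of splitting: arcs of equal colour and level, and arcs with a common
    -- target, where swapping changes no arc but cuts the walk at the repeated vertex.
    Exchange : Fin (suc m) → Fin (suc m) → Set
    Exchange i j = Adj (c i) (u i) (u (next j)) × Adj (c j) (u j) (u (next i)) ×
      (∀ v → wt (c i) (u i) (u (next i)) v + wt (c j) (u j) (u (next j)) v
           ≡ wt (c i) (u i) (u (next j)) v + wt (c j) (u j) (u (next i)) v)

    subst-pathIneq : ∀ {i j} (eq : i ≡ j) (p : Path (u i) x) v →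
      pathIneq (subst (λ k → Path (u k) x) eq p) v ≡ pathIneq p v
    subst-pathIneq refl p v = refl

    -- After the swap, one closed walk jumps from `s` to `t + 1` and returns to `s` through position
    -- `suc m`, which is position 0; the other jumps from `t` to `s + 1` and runs on to `t`.
    split-orbit : ∀ {s t} → s ℕ.< t → t ℕ.< suc m → Exchange (orbit s) (orbit t) →
      ∀ C → (∀ v → cycleIneq ℓ r C v ≡ walkIneq c u v) → IntCombSmaller ℓ r C
    split-orbit {s} {t} s<t t<1+m (a-st , a-ts , exchange) C C-eq = sum-of-two C
      (decompose (c (orbit s)) a-st outer)
      (decompose (c (orbit t)) a-ts (segment s<′t))
      sums
      where
      0≤′s : 0 ≤′ s
      0≤′s = ℕ.≤⇒≤′ ℕ.z≤n
      s<′t : suc s ≤′ t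
      s<′t = ℕ.≤⇒≤′ s<t
      t<′1+m : suc t ≤′ suc m
      t<′1+m = ℕ.≤⇒≤′ t<1+m
      start : Path (u (orbit (suc m))) (u (orbit s))
      start = subst (λ k → Path (u k) (u (orbit s))) (sym orbit-period) (segment 0≤′s)
      outer : Path (u (orbit (suc t))) (u (orbit s))
      outer = segment t<′1+m ◅◅ start
      module _ (v : Var ℓ r) where
        w : ℕ → ℤ
        w k = stepIneq k v
        X Y Z : ℤ
        X = pathIneq (segment 0≤′s) v
        Y = pathIneq (segment s<′t) v
        Z = pathIneq (segment t<′1+m) v
        wst wts : ℤ
        wst = wt (c (orbit s)) (u (orbit s)) (u (orbit (suc t))) v
        wts = wt (c (orbit t)) (u (orbit t)) (u (orbit (suc s))) v
        regroup₁ : ∀ X Y Z ws wt → Z + ((Y + ((X + 0ℤ) + ws)) + wt) ≡ (X + (Y + Z)) + (ws + wt)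
        regroup₁ = solve-∀
        regroup₂ : ∀ X Y Z ws wt → (X + (Y + Z)) + (ws + wt) ≡ (ws + (Z + X)) + (wt + Y)
        regroup₂ = solve-∀
        open ≡-Reasoning
        sums : cycleIneq ℓ r C v ≡ (wst + pathIneq outer v) + (wts + Y)
        sums = begin
          cycleIneq ℓ r C v                 ≡⟨ C-eq v ⟩
          walkIneq c u v                    ≡⟨ sumFin-orbit (λ i → wt (c i) (u i) (u (next i)) v) ⟩
          sumℕ< (suc m) w                   ≡⟨ segment-sum t<′1+m v ⟩
          Z + (sumℕ< t w + w t)             ≡⟨ cong (λ e → Z + (e + w t)) (segment-sum s<′t v) ⟩
          Z + ((Y + (sumℕ< s w + w s)) + w t)
            ≡⟨ cong (λ e → Z + ((Y + (e + w s)) + w t)) (segment-sum 0≤′s v) ⟩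
          Z + ((Y + ((X + 0ℤ) + w s)) + w t) ≡⟨ regroup₁ X Y Z (w s) (w t) ⟩
          (X + (Y + Z)) + (w s + w t)       ≡⟨ cong ((X + (Y + Z)) +_) (exchange v) ⟩
          (X + (Y + Z)) + (wst + wts)       ≡⟨ regroup₂ X Y Z wst wts ⟩
          (wst + (Z + X)) + (wts + Y)
            ≡⟨ cong (λ e → (wst + e) + (wts + Y)) (sym (trans (pathIneq-◅◅ (segment t<′1+m) start v)
                 (cong (Z +_) (subst-pathIneq (sym orbit-period) (segment 0≤′s) v)))) ⟩
          (wst + pathIneq outer v) + (wts + Y) ∎

    split : ∀ {i j} → i ≢ j → Exchange i j →
      ∀ C → (∀ v → cycleIneq ℓ r C v ≡ walkIneq c u v) → IntCombSmaller ℓ r C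
    split {i} {j} i≢j ex with ℕ.<-cmp (toℕ i) (toℕ j)
    ... | tri< i<j _ _ = split-orbit i<j (toℕ<n j) (subst₂ Exchange (sym (orbit-toℕ i)) (sym (orbit-toℕ j)) ex)
    ... | tri≈ _ i≡j _ = contradiction (toℕ-injective i≡j) i≢j
    ... | tri> _ _ j<i = split-orbit j<i (toℕ<n i) (subst₂ Exchange (sym (orbit-toℕ j)) (sym (orbit-toℕ i)) (swap ex))
      where
      swap : Exchange i j → Exchange j i
      swap (a-ij , a-ji , eq) = a-ji , a-ij , λ v →
        trans (ℤ.+-comm (wt (c j) (u j) (u (next j)) v) _)
          (trans (eq v) (ℤ.+-comm (wt (c i) (u i) (u (next j)) v) _))

  -- For a fixed colour the weight is a function of the source plus a function of the target.
  wt-exchange : ∀ c x y x′ y′ v → wt c x y v + wt c x′ y′ v ≡ wt c x y′ v + wt c x′ y v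
  wt-exchange c     x y x′ y′ (ℓv i) = exchange (δ ℓ r x i) (δ ℓ r y i) (δ ℓ r x′ i) (δ ℓ r y′ i)
    where
    exchange : ∀ a b c d → (a - b) + (c - d) ≡ (a - d) + (c - b)
    exchange = solve-∀
  wt-exchange true  x y x′ y′ (ρv i) = refl
  wt-exchange false x y x′ y′ (ρv i) = ℤ.+-comm (- δ ℓ r y i) (- δ ℓ r y′ i)
  wt-exchange c     x y x′ y′ cst    = refl

  level : (C : Cycle ℓ r) → Fin (size C) → ℕ
  level C i = out (colour C i) (at C i)

  SameLevel : ∀ C D → Fin (size C) → Fin (size D) → Set
  SameLevel C D i j = colour C i ≡ colour D j × level C i ≡ level D j

  split-same-level : ∀ C {i j} → i ≢ j → SameLevel C C i j → IntCombSmaller ℓ r C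
  split-same-level C {i} {j} i≢j (c≡ , l≡) = Walk.split (colour C) (at C) (adj C) i≢j
    ( subst (λ c → inn c (at C (next j)) ≡ level C i) (sym c≡) (trans (adj C j) (sym l≡))
    , subst (λ c → inn c (at C (next i)) ≡ level C j) c≡ (trans (adj C i) l≡)
    , subst (λ c → ∀ v → wt (colour C i) (at C i) (at C (next i)) v + wt c (at C j) (at C (next j)) v
                       ≡ wt (colour C i) (at C i) (at C (next j)) v + wt c (at C j) (at C (next i)) v)
        c≡ (wt-exchange (colour C i) (at C i) (at C (next i)) (at C j) (at C (next j))))
    C (cycleIneq-wt C)

  -- A turn uses a single endpoint of its vertex, `ℓ` from blue to red and `r` from red to blue, so
  -- a vertex that fits one of the two arcs fits the other.
  inn⇒out-not : ∀ c → inn c x ≡ inn c y → out (not c) x ≡ out (not c) y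
  inn⇒out-not true  eq = eq
  inn⇒out-not false eq = cong suc eq

  out⇒inn-not : ∀ c → out c x ≡ out c y → inn (not c) x ≡ inn (not c) y
  out⇒inn-not true  eq = ℕ.suc-injective eq
  out⇒inn-not false eq = eq

  -- The cycle changes from colour c to the other one at a vertex that x can replace.
  Turns : (C : Cycle ℓ r) → Vertex → Bool → Fin (size C) → Set
  Turns C x c i = colour C i ≡ c × colour C (next i) ≡ not c × inn c (at C (next i)) ≡ inn c x

  -- The turns have opposite directions: one needs only `ℓ x`, the other only `r x`. Putting `x` at
  -- both places keeps all arcs and the total, and the walk, now passing twice through `x`, is cut
  -- there.
  split-turns : ∀ C {x i j} → Turns C x true i → Turns C x false j → IntCombSmaller ℓ r C
  split-turns C {x} {i} {j} (ci , c-next-i , inn-i) (cj , c-next-j , inn-j) =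
    Walk.split (colour C) u u-adj i≢j exchange C λ v →
      trans (cycleIneq-wt C v) (walkIneq-cong (colour C) (at C) u straight v)
    where
    i≢j : i ≢ j
    i≢j refl with () ← trans (sym ci) cj

    u : Fin (size C) → Vertex
    u k with k ≟ next i | k ≟ next j
    ... | yes _ | _     = x
    ... | no _  | yes _ = x
    ... | no _  | no _  = at C k

    data View (k : Fin (size C)) : Set where
      at-i  : k ≡ next i → u k ≡ x → View k
      at-j  : k ≡ next j → u k ≡ x → View k
      other : u k ≡ at C k → View k

    view : ∀ k → View k
    view k with k ≟ next i | k ≟ next j | at-i {k} | at-j {k} | other {k}
    ... | yes eq | _      | via-i | _     | _     = via-i eq refl
    ... | no _   | yes eq | _     | via-j | _     = via-j eq refl
    ... | no _   | no _   | _     | _     | via-C = via-C refl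

    u-i : u (next i) ≡ x
    u-i with next i ≟ next i
    ... | yes _  = refl
    ... | no i≢i = contradiction refl i≢i

    u-j : u (next j) ≡ x
    u-j with next j ≟ next i | next j ≟ next j
    ... | yes _ | _      = refl
    ... | no _  | yes _  = refl
    ... | no _  | no j≢j = contradiction refl j≢j

    u-out : ∀ k → out (colour C k) (u k) ≡ level C k
    u-out k with view k
    ... | at-i refl eq = trans (cong (out (colour C k)) eq)
      (subst (λ c → out c x ≡ out c (at C k)) (sym c-next-i) (inn⇒out-not true (sym inn-i)))
    ... | at-j refl eq = trans (cong (out (colour C k)) eq)
      (subst (λ c → out c x ≡ out c (at C k)) (sym c-next-j) (inn⇒out-not false (sym inn-j)))
    ... | other eq     = cong (out (colour C k)) eq

    u-inn : ∀ k → inn (colour C k) (u (next k)) ≡ inn (colour C k) (at C (next k))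
    u-inn k with view (next k)
    ... | other eq     = cong (inn (colour C k)) eq
    ... | at-i k≡i eq with next-injective k≡i
    ... | refl = trans (cong (inn (colour C k)) eq)
      (subst (λ c → inn c x ≡ inn c (at C (next k))) (sym ci) (sym inn-i))
    u-inn k | at-j k≡j eq with next-injective k≡j
    ... | refl = trans (cong (inn (colour C k)) eq)
      (subst (λ c → inn c x ≡ inn c (at C (next k))) (sym cj) (sym inn-j))

    u-adj : ∀ k → Adj (colour C k) (u k) (u (next k))
    u-adj k = trans (u-inn k) (trans (adj C k) (sym (u-out k)))

    straight : ∀ k → colour C k ≡ colour C (next k) → at C (next k) ≡ u (next k)
    straight k c≡ with view (next k)
    ... | other eq = sym eq
    ... | at-i k≡i _ with refl ← next-injective k≡i with () ← trans (sym ci) (trans c≡ c-next-i)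
    ... | at-j k≡j _ with refl ← next-injective k≡j with () ← trans (sym cj) (trans c≡ c-next-j)

    u-ij : u (next i) ≡ u (next j)
    u-ij = trans u-i (sym u-j)

    exchange : Walk.Exchange (colour C) u u-adj i j
    exchange = subst (Adj (colour C i) (u i)) u-ij (u-adj i) , subst (Adj (colour C j) (u j)) (sym u-ij) (u-adj j) ,
      λ v → cong₂ _+_ (cong (λ y → wt (colour C i) (u i) y v) u-ij) (cong (λ y → wt (colour C j) (u j) y v) (sym u-ij))

  -- Nonnegative functionals

  -- Only ρ coefficients enter: on cycles the ℓ coefficients vanish, and the constant is determined
  -- by the ρ coefficients through `cst-eval`.
  eval : (Vertex → ℤ) → Ineq → ℤ
  eval h W = sumFin λ x → h x * W (ρv x)

  gain : (h φ : Vertex → ℤ) → Bool → Vertex → Vertex → ℤ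
  gain h φ c x y = (if c then h x else - h y) + (φ x - φ y)

  -- The potential φ telescopes along a cycle.
  eval-cycle : ∀ h φ C → eval h (cycleIneq ℓ r C) ≡ sumFin (λ i → gain h φ (colour C i) (at C i) (at C (next i)))
  eval-cycle h φ C = begin
      sumFin (λ x → h x * cycleIneq ℓ r C (ρv x))
        ≡⟨ sumFin-cong (λ x → trans (cong (h x *_) (cycleIneq-wt C (ρv x))) (sym (sumFin-*ˡ (h x) (λ i → w i x)))) ⟩
      sumFin (λ x → sumFin (λ i → h x * w i x))
        ≡⟨ sumFin-swap (λ x i → h x * w i x) ⟩
      sumFin (λ i → sumFin (λ x → h x * w i x))
        ≡⟨ sumFin-cong (λ i → pick (colour C i) (at C i) (at C (next i))) ⟩
      sumFin g
        ≡⟨ sym (ℤ.+-identityʳ (sumFin g)) ⟩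
      sumFin g + 0ℤ
        ≡⟨ cong (sumFin g +_) (sym telescope) ⟩
      sumFin g + sumFin (λ i → φ (at C i) - φ (at C (next i)))
        ≡⟨ sym (sumFin-+ g (λ i → φ (at C i) - φ (at C (next i)))) ⟩
      sumFin (λ i → gain h φ (colour C i) (at C i) (at C (next i))) ∎
    where
    open ≡-Reasoning
    w : Fin (size C) → Vertex → ℤ
    w i x = wt (colour C i) (at C i) (at C (next i)) (ρv x)
    g : Fin (size C) → ℤ
    g i = if colour C i then h (at C i) else - h (at C (next i))
    sum-δ : ∀ y → sumFin (λ x → h x * δ ℓ r y x) ≡ h y
    sum-δ y = trans (sumFin-pick (λ x → h x * δ ℓ r y x) y
        λ x x≢y → trans (cong (h x *_) (δ-≢ (x≢y ∘ sym))) (ℤ.*-zeroʳ (h x)))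
      (trans (cong (h y *_) (δ-refl y)) (ℤ.*-identityʳ (h y)))
    pick : ∀ c y z → sumFin (λ x → h x * wt c y z (ρv x)) ≡ (if c then h y else - h z)
    pick true  y z = sum-δ y
    pick false y z = trans (sumFin-cong λ x → sym (ℤ.neg-distribʳ-* (h x) (δ ℓ r z x)))
      (trans (sumFin-neg λ x → h x * δ ℓ r z x) (cong -_ (sum-δ z)))
    telescope : sumFin (λ i → φ (at C i) - φ (at C (next i))) ≡ 0ℤ
    telescope = trans (sumFin-- (φ ∘ at C) (φ ∘ at C ∘ next))
      (trans (cong (λ s → sumFin (φ ∘ at C) - s) (sumFin-next (φ ∘ at C))) (ℤ.+-inverseʳ (sumFin (φ ∘ at C))))

  evalℚ : (Vertex → ℤ) → List (ℚ × Cycle ℓ r) → ℚ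
  evalℚ h []            = 0ℚ
  evalℚ h ((α , D) ∷ L) = α ℚ.* ι (eval h (cycleIneq ℓ r D)) ℚ.+ evalℚ h L

  evalℚ-sumℚ : ∀ h L → sumFinℚ (λ x → ι (h x) ℚ.* sumℚ ℓ r L (ρv x)) ≡ evalℚ h L
  evalℚ-sumℚ h []            = sumFinℚ-zero (ι ∘ h)
  evalℚ-sumℚ h ((α , D) ∷ L) = trans
    (sumFinℚ-linear (ι ∘ h) (λ x → ι (cycleIneq ℓ r D (ρv x))) (λ x → sumℚ ℓ r L (ρv x)) α)
    (cong₂ (λ p q → α ℚ.* p ℚ.+ q)
      (sym (trans (ι-sumFin λ x → h x * cycleIneq ℓ r D (ρv x)) (sumFinℚ-cong λ x → ι-* (h x) _)))
      (evalℚ-sumℚ h L))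

  Combination : Cycle ℓ r → List (ℚ × Cycle ℓ r) → Set
  Combination C L = ∀ v → toℚ ℓ r (cycleIneq ℓ r C v) ≡ sumℚ ℓ r L v

  eval-combination : ∀ h C L → Combination C L → ι (eval h (cycleIneq ℓ r C)) ≡ evalℚ h L
  eval-combination h C L C≡L = trans
    (trans (ι-sumFin λ x → h x * cycleIneq ℓ r C (ρv x)) (sumFinℚ-cong λ x → trans (ι-* (h x) _)
      (cong (ι (h x) ℚ.*_) (C≡L (ρv x)))))
    (evalℚ-sumℚ h L)

  NonNeg : List (ℚ × Cycle ℓ r) → Set
  NonNeg = All (λ p → 0ℚ ℚ.≤ proj₁ p)

  product-nonNeg : ∀ {α z} → 0ℚ ℚ.≤ α → 0ℤ ≤ z → 0ℚ ℚ.≤ α ℚ.* ι z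
  product-nonNeg {α} {z} 0≤α 0≤z = subst (ℚ._≤ α ℚ.* ι z) (ℚ.*-zeroʳ α)
    (ℚ.*-monoˡ-≤-nonNeg α {{ℚ.nonNegative 0≤α}} (ι-mono-≤ 0≤z))

  module _ (h : Vertex → ℤ) (0≤h : ∀ D → 0ℤ ≤ eval h (cycleIneq ℓ r D)) where

    evalℚ-nonNeg : ∀ {L} → NonNeg L → 0ℚ ℚ.≤ evalℚ h L
    evalℚ-nonNeg []                       = ℚ.≤-refl
    evalℚ-nonNeg (_∷_ {x = α , D} 0≤α 0≤L) = ℚ.+-mono-≤ (product-nonNeg 0≤α (0≤h D)) (evalℚ-nonNeg 0≤L)

    evalℚ-zero : ∀ {L} → NonNeg L → evalℚ h L ≡ 0ℚ →
      ∀ {α D} → (α , D) ∈ L → α ≢ 0ℚ → eval h (cycleIneq ℓ r D) ≡ 0ℤ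
    evalℚ-zero (_∷_ {x = α , D} 0≤α 0≤L) eq (here refl) α≢0 = ι-injective
      (p*q≡0⇒q≡0 0≤α α≢0 (ι-mono-≤ (0≤h D))
        (p+q≡0⇒p≡0 (product-nonNeg 0≤α (0≤h D)) (evalℚ-nonNeg 0≤L) eq))
    evalℚ-zero {L = (α , D) ∷ L} (0≤α ∷ 0≤L) eq (there p∈L) α≢0 = evalℚ-zero 0≤L
      (p+q≡0⇒p≡0 (evalℚ-nonNeg 0≤L) (product-nonNeg 0≤α (0≤h D))
        (trans (ℚ.+-comm (evalℚ h L) _) eq)) p∈L α≢0

  -- Membership in P is certified by the vanishing of a nonnegative linear functional of the
  -- coefficients, so it passes from the arcs of a cycle to the arcs of the cycles summing to it.
  record Test : Set₁ where
    field
      h φ      : Vertex → ℤ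
      P        : Bool → Vertex → Vertex → Set
      nonNeg   : ∀ c x y → Adj c x y → 0ℤ ≤ gain h φ c x y
      sound    : ∀ c x y → Adj c x y → P c x y → gain h φ c x y ≡ 0ℤ
      complete : ∀ c x y → Adj c x y → gain h φ c x y ≡ 0ℤ → P c x y

    Passes : Cycle ℓ r → Set
    Passes C = ∀ i → P (colour C i) (at C i) (at C (next i))

  Inherits : Cycle ℓ r → Cycle ℓ r → Set₁
  Inherits C D = ∀ T → Test.Passes T C → Test.Passes T D

  -- Complementary slackness, carried down to arcs: the gains along `D` are nonnegative and sum to
  -- zero, so each of them is zero.
  inherits : ∀ {C L} → NonNeg L → Combination C L →
    ∀ {α D} → (α , D) ∈ L → α ≢ 0ℚ → Inherits C D
  inherits {C} {L} 0≤L C≡L {D = D} D∈L α≢0 T passes i = complete (colour D i) (at D i) (at D (next i)) (adj D i) (sumFin≡0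
      (λ j → nonNeg (colour D j) (at D j) (at D (next j)) (adj D j)) (trans (sym (eval-cycle h φ D)) (evalℚ-zero h 0≤h 0≤L L≡0 D∈L α≢0)) i)
    where
    open Test T
    0≤h : ∀ E → 0ℤ ≤ eval h (cycleIneq ℓ r E)
    0≤h E = subst (0ℤ ≤_) (sym (eval-cycle h φ E)) (sumFin-nonNeg λ j → nonNeg (colour E j) (at E j) (at E (next j)) (adj E j))
    L≡0 : evalℚ h L ≡ 0ℚ
    L≡0 = trans (sym (eval-combination h C L C≡L))
      (cong ι (trans (eval-cycle h φ C) (sumFin-0 λ j → sound (colour C j) (at C j) (at C (next j)) (adj C j) (passes j))))

  -- Tests for levels and for straight passages

  levelH levelφ : Bool → ℕ → Vertex → ℤ
  levelH true  k x = lt (r x) k - lt (ℓ x) k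
  levelH false k x = lt (r x) k - lt (ℓ x) (suc k)
  levelφ true  k x = lt (ℓ x) k
  levelφ false k x = lt (ℓ x) (suc k)

  ifSame : Bool → Bool → ℤ → ℤ → ℤ
  ifSame c d a b = if does (d Bool.≟ c) then a else b

  cancel : ∀ a b c → (a - b) + (b - c) ≡ a - c
  cancel = solve-∀

  cancel-neg : ∀ a b c → - (a - b) + (c - b) ≡ c - a
  cancel-neg = solve-∀

  -- As `ℓ x ≤ r x`, `levelH` is minus the indicator of `ℓ x < k ≤ r x` for blue and of
  -- `ℓ x ≤ k ≤ r x` for red. Adding the potential and matching the endpoints cancels the step
  -- functions up to one jump, so the functional counts the arcs of colour `c` at level `k`.
  level-gain : ∀ c k d x y → Adj d x y →
    gain (levelH c k) (levelφ c k) d x y ≡ ifSame c d (ind (out c x ℕ.≟ k)) 0ℤ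
  level-gain true  k true  x y a rewrite a =
    trans (cancel (lt (r x) k) (lt (ℓ x) k) (lt (suc (r x)) k)) (lt-sucˡ (r x) k)
  level-gain true  k false x y a rewrite a =
    trans (cancel-neg (lt (ℓ x) k) (lt (ℓ y) k) (lt (ℓ x) k)) (ℤ.+-inverseʳ (lt (ℓ x) k))
  level-gain false k true  x y a rewrite a =
    trans (cancel (lt (r x) k) (lt (ℓ x) (suc k)) (lt (r x) k)) (ℤ.+-inverseʳ (lt (r x) k))
  level-gain false k false x y a rewrite a =
    trans (cancel-neg (lt (ℓ x) k) (lt (ℓ y) (suc k)) (lt (ℓ x) (suc k))) (lt-sucʳ (ℓ x) k)

  levelTest : Bool → ℕ → Test
  levelTest c k = record
    { h        = levelH c k
    ; φ        = levelφ c k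
    ; P        = λ d x y → d ≡ c → out c x ≢ k
    ; nonNeg   = λ d x y a → subst (0ℤ ≤_) (sym (level-gain c k d x y a)) (nonNeg d x)
    ; sound    = λ d x y a p → trans (level-gain c k d x y a) (sound d x p)
    ; complete = λ d x y a eq → complete d x (trans (sym (level-gain c k d x y a)) eq)
    }
    where
    value : Bool → Vertex → ℤ
    value d x = ifSame c d (ind (out c x ℕ.≟ k)) 0ℤ
    nonNeg : ∀ d x → 0ℤ ≤ value d x
    nonNeg d x with d Bool.≟ c
    ... | yes _ = ind-nonNeg (out c x ℕ.≟ k)
    ... | no _  = ℤ.≤-refl
    sound : ∀ d x → (d ≡ c → out c x ≢ k) → value d x ≡ 0ℤ
    sound d x p with d Bool.≟ c
    ... | yes d≡c = ind-no (out c x ℕ.≟ k) (p d≡c)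
    ... | no _    = refl
    complete : ∀ d x → value d x ≡ 0ℤ → d ≡ c → out c x ≢ k
    complete d x eq d≡c with d Bool.≟ c
    ... | yes _  = ind-zero (out c x ℕ.≟ k) eq
    ... | no d≢c = contradiction d≡c d≢c

  gain-+ : ∀ h φ h′ φ′ d x y →
    gain (λ x → h x + h′ x) (λ x → φ x + φ′ x) d x y ≡ gain h φ d x y + gain h′ φ′ d x y
  gain-+ h φ h′ φ′ true  x y = regroup (h x) (h′ x) (φ x) (φ′ x) (φ y) (φ′ y)
    where
    regroup : ∀ a a′ b b′ c c′ → (a + a′) + ((b + b′) - (c + c′)) ≡ (a + (b - c)) + (a′ + (b′ - c′))
    regroup = solve-∀
  gain-+ h φ h′ φ′ false x y = regroup (h y) (h′ y) (φ x) (φ′ x) (φ y) (φ′ y)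
    where
    regroup : ∀ a a′ b b′ c c′ → - (a + a′) + ((b + b′) - (c + c′)) ≡ (- a + (b - c)) + (- a′ + (b′ - c′))
    regroup = solve-∀

  -- On a cycle, `straightH` evaluates to -1 for a passage through `y` in colour `c` throughout and
  -- to 1 for one in the other colour. The potentials decide which arc is charged with it: `enterφ`
  -- the `c`-coloured arc into `y`, `leaveφ` the one out of `y`.
  module Straight (c : Bool) (y : Vertex) where
    d : Vertex → ℤ
    d x = ind (x ≟ y)

    straightH enterφ leaveφ : Vertex → ℤ
    straightH x = if c then - d x else d x
    enterφ x = if c then d x else 0ℤ
    leaveφ x = if c then 0ℤ else - d x

  straight-enter : ∀ c y e x z → let open Straight c y in
    gain straightH enterφ e x z ≡ ifSame c e (- d z) (d x)
  straight-enter true y true x z = lemma (d x) (d z)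
    where
    open Straight true y
    lemma : ∀ a b → - a + (a - b) ≡ - b
    lemma = solve-∀
  straight-enter true y false x z = lemma (d x) (d z)
    where
    open Straight true y
    lemma : ∀ a b → - (- b) + (a - b) ≡ a
    lemma = solve-∀
  straight-enter false y true  x z = ℤ.+-identityʳ _
  straight-enter false y false x z = ℤ.+-identityʳ _

  straight-leave : ∀ c y e x z → let open Straight c y in
    gain straightH leaveφ e x z ≡ ifSame c e (- d x) (d z)
  straight-leave true  y true  x z = ℤ.+-identityʳ _
  straight-leave true  y false x z = trans (ℤ.+-identityʳ _) (ℤ.neg-involutive _)
  straight-leave false y true x z = lemma (d x) (d z)
    where
    open Straight false y
    lemma : ∀ a b → a + (- a - - b) ≡ b
    lemma = solve-∀
  straight-leave false y false x z = lemma (d x) (d z)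
    where
    open Straight false y
    lemma : ∀ a b → - b + (- a - - b) ≡ - a
    lemma = solve-∀

  ifSame-+ : ∀ c e a b a′ b′ → ifSame c e a b + ifSame c e a′ b′ ≡ ifSame c e (a + a′) (b + b′)
  ifSame-+ c e a b a′ b′ with e Bool.≟ c
  ... | yes _ = refl
  ... | no _  = refl

  -- The common form of `enterTest` and `leaveTest`. The summand `0ℤ` is the level gain of an arc of
  -- the other colour.
  module _ (c : Bool) (h φ : Vertex → ℤ) {A B A′ : Vertex → Vertex → Set}
    (A? : ∀ x z → Dec (A x z)) (B? : ∀ x z → Dec (B x z)) (A′? : ∀ x z → Dec (A′ x z))
    (B⇒A : ∀ x z → Adj c x z → B x z → A x z)
    (h-gain : ∀ e x z → Adj e x z →
      gain h φ e x z ≡ ifSame c e (ind (A? x z) - ind (B? x z)) (0ℤ + ind (A′? x z))) where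

    straightTest : Test
    straightTest = record
      { h        = h
      ; φ        = φ
      ; P        = λ e x z → (e ≡ c → A x z → B x z) × (e ≢ c → ¬ A′ x z)
      ; nonNeg   = λ e x z a → subst (0ℤ ≤_) (sym (h-gain e x z a)) (nonNeg e x z a)
      ; sound    = λ e x z a p → trans (h-gain e x z a) (sound e x z a p)
      ; complete = λ e x z a eq → complete e x z (trans (sym (h-gain e x z a)) eq)
      }
      where
      value : Bool → Vertex → Vertex → ℤ
      value e x z = ifSame c e (ind (A? x z) - ind (B? x z)) (0ℤ + ind (A′? x z))
      nonNeg : ∀ e x z → Adj e x z → 0ℤ ≤ value e x z
      nonNeg e x z a with e Bool.≟ c
      ... | yes refl = ind-difference-nonNeg (A? x z) (B? x z) (B⇒A x z a)
      ... | no _     = subst (0ℤ ≤_) (sym (ℤ.+-identityˡ (ind (A′? x z)))) (ind-nonNeg (A′? x z))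
      sound : ∀ e x z → Adj e x z → (e ≡ c → A x z → B x z) × (e ≢ c → ¬ A′ x z) → value e x z ≡ 0ℤ
      sound e x z a (A⇒B , ¬A′) with e Bool.≟ c
      ... | yes refl = ind-difference-sound (A? x z) (B? x z) (B⇒A x z a) (A⇒B refl)
      ... | no e≢c   = trans (ℤ.+-identityˡ (ind (A′? x z))) (ind-no (A′? x z) (¬A′ e≢c))
      complete : ∀ e x z → value e x z ≡ 0ℤ → (e ≡ c → A x z → B x z) × (e ≢ c → ¬ A′ x z)
      complete e x z eq with e Bool.≟ c
      ... | yes e≡c = (λ _ → ind-difference-complete (A? x z) (B? x z) eq) , λ e≢c → contradiction e≡c e≢c
      ... | no e≢c  = (λ e≡c → contradiction e≡c e≢c) ,
        λ _ → ind-zero (A′? x z) (trans (sym (ℤ.+-identityˡ (ind (A′? x z)))) eq)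

  -- A cycle passes if its `c`-coloured arcs at level `k` all enter `y` and no arc of the other
  -- colour leaves `y`. The choice of `k` makes every `c`-coloured arc into `y` have level `k`, so
  -- the difference of indicators is nonnegative.
  enterTest : Bool → Vertex → Test
  enterTest c y = straightTest c
    (λ x → levelH c k x + Straight.straightH c y x)
    (λ x → levelφ c k x + Straight.enterφ c y x)
    (λ x z → out c x ℕ.≟ k) (λ x z → z ≟ y) (λ x z → x ≟ y)
    (λ x z a z≡y → trans (sym a) (cong (inn c) z≡y))
    λ e x z a → trans
      (gain-+ (levelH c k) (levelφ c k) (Straight.straightH c y) (Straight.enterφ c y) e x z)
      (trans (cong₂ _+_ (level-gain c k e x z a) (straight-enter c y e x z))
        (ifSame-+ c e (ind (out c x ℕ.≟ k)) 0ℤ (- ind (z ≟ y)) (ind (x ≟ y))))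
    where
    k : ℕ
    k = inn c y

  leaveTest : Bool → Vertex → Test
  leaveTest c y = straightTest c
    (λ x → levelH c k x + Straight.straightH c y x)
    (λ x → levelφ c k x + Straight.leaveφ c y x)
    (λ x z → out c x ℕ.≟ k) (λ x z → x ≟ y) (λ x z → z ≟ y)
    (λ x z a x≡y → cong (out c) x≡y)
    λ e x z a → trans
      (gain-+ (levelH c k) (levelφ c k) (Straight.straightH c y) (Straight.leaveφ c y) e x z)
      (trans (cong₂ _+_ (level-gain c k e x z a) (straight-leave c y e x z))
        (ifSame-+ c e (ind (out c x ℕ.≟ k)) 0ℤ (- ind (x ≟ y)) (ind (z ≟ y))))
    where
    k : ℕ
    k = out c y

  -- Rigid cycles

  length-gain : ∀ d x y → Adj d x y →
    gain (λ x → pos (ℓ x) - pos (r x)) (λ x → - pos (ℓ x)) d x y ≡ 𝟙 d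
  length-gain true  x y a rewrite a = lemma (pos (ℓ x)) (pos (r x))
    where
    lemma : ∀ a b → (a - b) + (- a - - (1ℤ + b)) ≡ 1ℤ
    lemma = solve-∀
  length-gain false x y a rewrite a = lemma (pos (ℓ x)) (pos (ℓ y))
    where
    lemma : ∀ a b → - (b - a) + (- a - - b) ≡ 0ℤ
    lemma = solve-∀

  -- The lengths r x - ℓ x satisfy every cycle inequality with equality.
  cst-eval : ∀ C → cycleIneq ℓ r C cst ≡ eval (λ x → pos (ℓ x) - pos (r x)) (cycleIneq ℓ r C)
  cst-eval C = trans (cycleIneq-wt C cst) (sym (trans
    (eval-cycle (λ x → pos (ℓ x) - pos (r x)) (λ x → - pos (ℓ x)) C)
    (sumFin-cong λ i → length-gain (colour C i) (at C i) (at C (next i)) (adj C i))))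

  coeff-Equiv : ∀ C D → (∀ x → coeff D x ≡ coeff C x) → Equiv ℓ r (cycleIneq ℓ r D) (cycleIneq ℓ r C)
  coeff-Equiv C D eq (ℓv x) = trans (cycleIneq-ℓ D x) (sym (cycleIneq-ℓ C x))
  coeff-Equiv C D eq (ρv x) = eq x
  coeff-Equiv C D eq cst    = trans (cst-eval D)
    (trans (sumFin-cong λ x → cong ((pos (ℓ x) - pos (r x)) *_) (eq x)) (sym (cst-eval C)))

  ≢⇒≡not : ∀ {c d} → d ≢ c → d ≡ not c
  ≢⇒≡not {true}  {true}  d≢c = contradiction refl d≢c
  ≢⇒≡not {true}  {false} d≢c = refl
  ≢⇒≡not {false} {true}  d≢c = refl
  ≢⇒≡not {false} {false} d≢c = contradiction refl d≢c

  not-≢ : ∀ {c d} → d ≡ not c → d ≢ c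
  not-≢ d≡not d≡c = Bool.not-¬ d≡c d≡not

  UniqueLevels : Cycle ℓ r → Set
  UniqueLevels C = ∀ i j → SameLevel C C i j → i ≡ j

  NoTurns : Cycle ℓ r → Set
  NoTurns C = ∀ x i j → Turns C x true i → ¬ Turns C x false j

  adj-colour : ∀ C {c i} → colour C i ≡ c → inn c (at C (next i)) ≡ out c (at C i)
  adj-colour C {i = i} refl = adj C i

  -- Under these hypotheses the arcs of D are forced to follow those of C one by one.
  module _ (C D : Cycle ℓ r) (inherited : Inherits C D) (unique : UniqueLevels C) (noTurns : NoTurns C) where

    -- Levels are matched instead of vertices, since the vertices of `C` and `D` may differ at
    -- turns.
    record Tracks (c : Bool) (i : Fin (size D)) (j : Fin (size C)) : Set where
      constructor tracks
      field
        colour-D : colour D i ≡ c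
        colour-C : colour C j ≡ c
        out-≡    : out c (at D i) ≡ out c (at C j)

    unique-out : ∀ {c i j} → colour C i ≡ c → colour C j ≡ c → out c (at C i) ≡ out c (at C j) → i ≡ j
    unique-out {i = i} {j} refl cj eq =
      unique i j (sym cj , trans eq (cong (λ d → out d (at C j)) (sym cj)))

    -- Were colour and level of arc `i` missing from `C`, their `levelTest` would pass on `C`, hence
    -- on `D`, and arc `i` refutes that.
    tracked : ∀ {c} i → colour D i ≡ c → ∃ λ j → Tracks c i j
    tracked {c} i ci with any? (λ j → (colour C j Bool.≟ c) ×-dec (out c (at C j) ℕ.≟ out c (at D i)))
    ... | yes (j , cj , eq) = j , tracks ci cj (sym eq)
    ... | no none = contradiction refl
      (inherited (levelTest c (out c (at D i))) (λ j cj eq → none (j , cj , eq)) i ci)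

    no-turns : ∀ c {x i j} → Turns C x c i → ¬ Turns C x (not c) j
    no-turns true  {x} {i} {j} ti tj = noTurns x i j ti tj
    no-turns false {x} {i} {j} ti tj = noTurns x j i tj ti

    enterTest-passes : ∀ {c} j → colour C j ≡ c → colour C (next j) ≡ c →
      Test.Passes (enterTest c (at C (next j))) C
    enterTest-passes j cj c-next k =
      (λ ck eq → cong (at C ∘ next) (unique-out ck cj (trans eq (adj-colour C cj)))) ,
      λ ck≢ eq → ck≢ (trans (cong (colour C) (Cycle.inj C k (next j) eq)) c-next)

    leaveTest-passes : ∀ {c} j → colour C j ≡ c → colour C (next j) ≡ c →
      Test.Passes (leaveTest c (at C (next j))) C
    leaveTest-passes j cj c-next k =
      (λ ck eq → cong (at C) (unique-out ck c-next eq)) ,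
      λ ck≢ eq → ck≢ (trans (cong (colour C) (next-injective (Cycle.inj C _ _ eq))) cj)

    module _ {c i j} (tr : Tracks c i j) where
      open Tracks tr

      inn-≡ : inn c (at D (next i)) ≡ inn c (at C (next j))
      inn-≡ = trans (adj-colour D colour-D) (trans out-≡ (sym (adj-colour C colour-C)))

      advance-straight : colour C (next j) ≡ c → at D (next i) ≡ at C (next j) × Tracks c (next i) (next j)
      advance-straight c-next = at-≡ , tracks colour-next c-next (cong (out c) at-≡)
        where
        passes : Test.Passes (enterTest c (at C (next j))) D
        passes = inherited (enterTest c (at C (next j))) (enterTest-passes j colour-C c-next)
        at-≡ : at D (next i) ≡ at C (next j)
        at-≡ = proj₁ (passes i) colour-D (trans out-≡ (sym (adj-colour C colour-C)))
        colour-next : colour D (next i) ≡ c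
        colour-next = decidable-stable (colour D (next i) Bool.≟ c) λ c≢ → proj₂ (passes (next i)) c≢ at-≡

      -- If D went straight on, C would either turn back to c at a vertex that at D (next i) can
      -- replace, or run straight through at D (next i), which would have to be at C (next j).
      turn-forced : colour C (next j) ≡ not c → colour D (next i) ≢ c
      turn-forced c-next cD with tracked (next i) cD
      ... | j′ , tracks _ cj′ out-≡′ with next-surjective j′
      ... | p , refl with colour C p Bool.≟ c
      ... | no cp≢ = no-turns c
        (colour-C , c-next , sym inn-≡)
        (≢⇒≡not cp≢ , trans cj′ (sym (Bool.not-involutive c)) , out⇒inn-not c (sym out-≡′))
      ... | yes cp = not-≢ c-next (trans (cong (colour C ∘ next) (sym p≡j)) cj′)
        where
        at-≡ : at D (next i) ≡ at C (next p)
        at-≡ = proj₁ (inherited (leaveTest c (at C (next p))) (leaveTest-passes p cp cj′) (next i)) cD out-≡′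
        p≡j : p ≡ j
        p≡j = unique-out cp colour-C (trans (sym (adj-colour C cp))
          (trans (cong (inn c) (sym at-≡)) (trans inn-≡ (adj-colour C colour-C))))

      advance-turn : colour C (next j) ≡ not c → Tracks (not c) (next i) (next j)
      advance-turn c-next = tracks (≢⇒≡not (turn-forced c-next)) c-next (inn⇒out-not c inn-≡)

      advance : ∃ λ d → Tracks d (next i) (next j)
      advance with colour C (next j) Bool.≟ c
      ... | yes c-next = c , proj₂ (advance-straight c-next)
      ... | no c-next≢ = not c , advance-turn (≢⇒≡not c-next≢)

    -- The counterpart of `tracked`: stepping on from one matched pair runs through all arcs of `C`,
    -- so each is matched by an arc of `D`.
    tracking : ∀ j → ∃ λ i → ∃ λ c → Tracks c i j
    tracking = next-induction (λ j → ∃ λ i → ∃ λ c → Tracks c i j)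
      (λ (i , _ , tr) → next i , advance tr)
      (zero , colour D zero , proj₂ (tracked zero refl))

    -- A straight passage of `D` at `x` is matched in `C`, because a turn of `C` there would force
    -- `D` to turn. If `D` has none at `x`, neither has `C`, by `tracking`.
    same-coeff : ∀ x → coeff D x ≡ coeff C x
    same-coeff x with any? (λ i → (at D (next i) ≟ x) ×-dec (colour D i Bool.≟ colour D (next i)))
    ... | yes (i , refl , straight) with tracked i refl
    ... | j , tr with colour C (next j) Bool.≟ colour D i
    ... | no c-next≢ = contradiction (sym straight) (turn-D (advance-turn tr (≢⇒≡not c-next≢)))
      where
      turn-D : Tracks (not (colour D i)) (next i) (next j) → colour D (next i) ≢ colour D i
      turn-D tr′ = not-≢ (Tracks.colour-D tr′)
    ... | yes c-next = begin
        coeff D (at D (next i)) ≡⟨ coeff-at D i ⟩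
        turnAt D i              ≡⟨ cong₂ turn (sym (Tracks.colour-C tr)) (trans (sym straight) (sym c-next)) ⟩
        turnAt C j              ≡⟨ sym (coeff-at C j) ⟩
        coeff C (at C (next j)) ≡⟨ cong (coeff C) (sym (proj₁ (advance-straight tr c-next))) ⟩
        coeff C (at D (next i)) ∎
      where open ≡-Reasoning
    same-coeff x | no none = trans
      (coeff-away D x λ i eq → turn-≢ _ _ λ straight → none (i , eq , straight))
      (sym (coeff-away C x λ j eq → turn-≢ _ _ (turns j eq)))
      where
      turns : ∀ j → at C (next j) ≡ x → colour C j ≢ colour C (next j)
      turns j eq straight with tracking j
      ... | i , c , tr with advance-straight tr (trans (sym straight) (Tracks.colour-C tr))
      ... | at-≡ , tr′ = none (i , trans at-≡ eq , trans (Tracks.colour-D tr) (sym (Tracks.colour-D tr′)))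

  -- Irredundance of rigid cycles and the two implications

  evalℚ-zeros : ∀ h {L} → All (λ p → proj₁ p ≡ 0ℚ) L → evalℚ h L ≡ 0ℚ
  evalℚ-zeros h []                               = refl
  evalℚ-zeros h (_∷_ {x = α , D} refl αs≡0) = cong₂ ℚ._+_
    (ℚ.*-zeroˡ (ι (eval h (cycleIneq ℓ r D)))) (evalℚ-zeros h αs≡0)

  -- The functional counting arcs with the colour and level of the first arc of `C` is positive on
  -- `C`, but zero on a combination with zero weights.
  not-all-zero : ∀ C L → Combination C L → ¬ All (λ p → proj₁ p ≡ 0ℚ) L
  not-all-zero C L C≡L αs≡0 = complete c (at C zero) (at C (next zero)) (adj C zero)
      (sumFin≡0 (λ i → nonNeg (colour C i) (at C i) (at C (next i)) (adj C i)) sum≡0 zero) refl refl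
    where
    c : Bool
    c = colour C zero
    open Test (levelTest c (level C zero))
    sum≡0 : sumFin (λ i → gain h φ (colour C i) (at C i) (at C (next i))) ≡ 0ℤ
    sum≡0 = trans (sym (eval-cycle h φ C))
      (ι-injective (trans (eval-combination h C L C≡L) (evalℚ-zeros h αs≡0)))

  rigid⇒irredundant : ∀ C → UniqueLevels C → NoTurns C → ¬ Redundant ℓ r C
  rigid⇒irredundant C unique noTurns (L , conditions , C≡L) = not-all-zero C L C≡L
    (All.tabulate λ {p} p∈L → decidable-stable (proj₁ p ℚ.≟ 0ℚ) λ α≢0 →
      proj₂ (All.lookup conditions p∈L)
        (coeff-Equiv C (proj₂ p)
          (same-coeff C (proj₂ p) (inherits {C} (All.map proj₁ conditions) C≡L p∈L α≢0) unique noTurns)))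

  turns? : ∀ C x c i → Dec (Turns C x c i)
  turns? C x c i = (colour C i Bool.≟ c) ×-dec ((colour C (next i) Bool.≟ not c) ×-dec
    (inn c (at C (next i)) ℕ.≟ inn c x))

  redundant⇒integral : ∀ C → Redundant ℓ r C → IntCombSmaller ℓ r C
  redundant⇒integral C redundant
    with any? (λ i → any? λ j → ¬? (i ≟ j) ×-dec ((colour C i Bool.≟ colour C j) ×-dec (level C i ℕ.≟ level C j)))
       | any? (λ x → any? λ i → any? λ j → turns? C x true i ×-dec turns? C x false j)
  ... | yes (i , j , i≢j , same) | _ = split-same-level C i≢j same
  ... | no _ | yes (x , i , j , ti , tj) = split-turns C ti tj
  ... | no distinct | no noTurns = contradiction redundant (rigid⇒irredundant C
    (λ i j same → decidable-stable (i ≟ j) λ i≢j → distinct (i , j , i≢j , same))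
    (λ x i j ti tj → noTurns (x , i , j , ti , tj)))

  toRational : List (ℕ × Cycle ℓ r) → List (ℚ × Cycle ℓ r)
  toRational = map λ (k , D) → ι (pos k) , D

  sumℚ-toRational : ∀ L v → sumℚ ℓ r (toRational L) v ≡ ι (sumℕ ℓ r L v)
  sumℚ-toRational []            v = refl
  sumℚ-toRational ((k , D) ∷ L) v = sym (trans (ι-+ (pos k * cycleIneq ℓ r D v) (sumℕ ℓ r L v))
    (cong₂ ℚ._+_ (ι-* (pos k) (cycleIneq ℓ r D v)) (sym (sumℚ-toRational L v))))

  integral⇒redundant : ∀ C → IntCombSmaller ℓ r C → Redundant ℓ r C
  integral⇒redundant C (L , smaller , C≡L) = toRational L , All.map⁺ (All.map (λ {p} → conditions {p}) smaller) ,
    λ v → trans (cong ι (C≡L v)) (sym (sumℚ-toRational L v))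
    where
    conditions : ∀ {p} → WeakSmaller ℓ r (proj₂ p) C →
      (0ℚ ℚ.≤ ι (pos (proj₁ p))) × ¬ Equiv ℓ r (cycleIneq ℓ r (proj₂ p)) (cycleIneq ℓ r C)
    conditions {k , D} smaller = ι-mono-≤ {0ℤ} {pos k} (ℤ.+≤+ ℕ.z≤n) , λ D≈C → Equiv⇒¬WeakSmaller {C} {D} D≈C smaller

theorem5p8 : (n : ℕ) (ℓ r : Fin n → ℕ) → IsCanonical ℓ r →
    (C : Cycle ℓ r) → Redundant ℓ r C ⇔ IntCombSmaller ℓ r C
theorem5p8 n ℓ r (repr , _) C = mk⇔ (redundant⇒integral C) (integral⇒redundant C)
  where open KeyGraph ℓ r repr
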